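{- Let $\kappa$ be a regular uncountable cardinal and $\chi<\kappa$ a cardinal such that $\lambda^{<\chi}<\kappa$ for all $\lambda<\kappa$ and $\mathrm{P}_{14}(\kappa,\sqsubseteq,\kappa,\{E^\kappa_{\ge\chi}\})$ holds. Then there exists a downward-closed $T\subseteq{}^{<\kappa}\kappa$ which is a prolific slim $\chi$-free $\kappa$-Souslin tree.
   Context: Downward-closed subsets of ${}^{<\kappa}\kappa$ are ordered by $\subsetneq$, height $=\mathrm{dom}$, $T_\alpha=T\cap{}^\alpha\kappa$. Prolific: $x^\frown\langle i\rangle\in T$ for $x\in T_\alpha$, $i<\max\{\omega,\alpha\}$. Slim: $|T_\alpha|\le\max\{|\alpha|,\aleph_0\}$. $\kappa$-Souslin: height $\kappa$, levels of size $<\kappa$, no cofinal branch, no antichain of size $\kappa$. $T^\tau=\{f:\tau\to T\mid\mathrm{ht}\circ f$ constant$\}$; for nonzero $\tau$, $\beta<\kappa$ and distinct $\langle w_i\mid i<\tau\rangle\in{}^\tau T_\beta$, the derived tree $\bigotimes_{i<\tau}w_i^\uparrow$ is the set of $f\in T^\tau$ with each $f(i)$ compatible with $w_i$, ordered by $f<g$ iff $f(i)\subsetneq g(i)$ for all $i$. $T$ is $\chi$-free if all such derived trees with $0<\tau<\chi$ are $\kappa$-Souslin. $E^\kappa_{\ge\chi}=\{\alpha<\kappa\mid\mathrm{cf}(\alpha)\ge\chi\}$. $\mathrm{P}_{14}(\kappa,\sqsubseteq,\kappa,\{S\})$: $\diamondsuit(\kappa)$ holds and there is $\langle C_\alpha\mid\alpha<\kappa\rangle$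 with $C_\alpha$ club in $\alpha$ for limit $\alpha$, $C_{\bar\alpha}=C_\alpha\cap\bar\alpha$ for $\bar\alpha\in\mathrm{acc}(C_\alpha)=\{\gamma\in C_\alpha\mid\sup(C_\alpha\cap\gamma)=\gamma>0\}$, and for every sequence $\langle A_i\mid i<\kappa\rangle$ of cofinal subsets of $\kappa$ there are stationarily many $\alpha\in S$ with $\sup\{\beta\in C_\alpha\mid\mathrm{succ}_\omega(C_\alpha\setminus\beta)\subseteq A_i\}=\alpha$ for all $i<\alpha$, where $\mathrm{succ}_\omega(D)=\{\delta\in D\mid0<\mathrm{otp}(D\cap\delta)<\omega\}$. -}

module Defs where

open import Data.Fin.Base using (Fin)
open import Data.Nat.Base using (ℕ)
open import Data.Irrelevant using ([_])
open import Data.Product using (Σ; Σ-syntax; ∃; ∃-syntax; _×_; _,_; proj₁; proj₂)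
open import Data.Refinement using (Refinement; value; _,_)
open import Data.Sum using (_⊎_)
open import Function using (Injection; _↣_; _↔_; Injective; _on_)
open import Induction.WellFounded using (WellFounded)
open import Level using (Level; 0ℓ; suc)
open import Relation.Binary
  using (Rel; Setoid; StrictPartialOrder; StrictTotalOrder; IsStrictTotalOrder)
import Relation.Binary.Construct.On as On
import Relation.Binary.Construct.StrictToNonStrict as ToNonStrict
open import Relation.Binary.Morphism.Structures using (IsOrderIsomorphism)
open import Relation.Binary.PropositionalEquality as ≡ using (_≡_)
open import Relation.Nullary using (¬_)
open import Relation.Unary
  using (Pred; _∈_; _⊆_; _⊂_; _≐_; _∩_; _∪_; U; ｛_｝; Satisfiable)
open import Relation.Unary.Relation.Binary.Subset using (⊂-strictPartialOrder)

-- The background theory is ZFC, rendered by the hypothesis `ExcludedMiddle`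
-- of the standard library.  It decides every type, not just every
-- proposition, so it turns ¬ ¬ (∃ x, P x) into a witness and thereby also
-- yields the axiom of choice.

-- An ordinal is a well-ordered type; its elements are the smaller ordinals.
record Ordinal ℓ : Set (suc ℓ) where
  infix 4 _<_
  field
    Carrier            : Set ℓ
    _<_                : Rel Carrier ℓ
    isStrictTotalOrder : IsStrictTotalOrder _≡_ _<_
    wellFounded        : WellFounded _<_

module _ {ℓ : Level} where

  SPO : Set (suc ℓ)
  SPO = StrictPartialOrder ℓ ℓ ℓ

  ∥_∥ : SPO → Set ℓ
  ∥_∥ = StrictPartialOrder.Carrier

  infixl 5 _↾_
  _↾_ : (P : SPO) → Pred ∥ P ∥ ℓ → SPO
  P ↾ X = On.strictPartialOrder {B = Σ ∥ P ∥ X} P proj₁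

  infix 4 _≅_
  _≅_ : SPO → SPO → Set ℓ
  P ≅ Q = ∃ λ (f : ∥ P ∥ → ∥ Q ∥) →
      IsOrderIsomorphism P._≈_ Q._≈_ P._<_ Q._<_ f
    where
    module P = StrictPartialOrder P
    module Q = StrictPartialOrder Q

module OnOrdinal {ℓ : Level} (κ : Ordinal ℓ) where

  open Ordinal κ public using (_<_) renaming (Carrier to K)
  open ToNonStrict {A = K} _≡_ _<_ public using (_≤_)

  κ-order : SPO
  κ-order = StrictTotalOrder.strictPartialOrder
    record { isStrictTotalOrder = Ordinal.isStrictTotalOrder κ }

  -- The ordinal α as the set of its elements.
  Seg : K → Set ℓ
  Seg α = Refinement K (_< α)

  seg : K → SPO
  seg α = On.strictPartialOrder {B = Seg α} κ-order value

  OrderType : SPO → K → Set ℓ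
  OrderType P α = P ≅ seg α

  Positive : Pred K ℓ
  Positive α = ∃[ β ] β < α

  IsLimit : Pred K ℓ
  IsLimit α = Positive α × (∀ β → β < α → ∃[ γ ] (β < γ × γ < α))

  _<ω : Pred K ℓ
  γ <ω = ∃[ n ] (Seg γ ↔ Fin n)

  ∣_∣≤_ : Setoid ℓ ℓ → K → Set ℓ
  ∣ S ∣≤ α = Injection S (≡.setoid (Seg α))

  ∣_∣≤ℵ₀ : Setoid ℓ ℓ → Set ℓ
  ∣ S ∣≤ℵ₀ = Injection S (≡.setoid ℕ)

  -- When κ is a cardinal, a set has size < κ iff it injects into some α < κ.
  ∣_∣<κ : Setoid ℓ ℓ → Set ℓ
  ∣ S ∣<κ = ∃[ α ] ∣ S ∣≤ α

  IsCardinal : Pred K ℓ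
  IsCardinal μ = ∀ α → α < μ → ¬ (Seg μ ↣ Seg α)

  -- In what follows the set P is an ordinal ≤ κ: either U, which is κ
  -- itself, or (_< α), which is α < κ.

  CofinalIn : ∀ {p} → Pred K p → Pred K ℓ → Set _
  CofinalIn P A = A ⊆ P × (∀ β → β ∈ P → ∃[ α ] (α ∈ A × β ≤ α))

  CofinalMap : ∀ {p} → K → Pred K p → Set _
  CofinalMap δ P = Σ[ f ∈ (Seg δ → K) ]
    ((∀ i → f i ∈ P) × (∀ β → β ∈ P → ∃[ i ] β ≤ f i))

  HasCofinality : K → K → Set ℓ
  HasCofinality α γ =
    CofinalMap γ (_< α) × (∀ δ → δ < γ → ¬ CofinalMap δ (_< α))

  E≥ : K → Pred K ℓ
  E≥ χ α = ∃[ γ ] (HasCofinality α γ × χ ≤ γ)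

  record IsRegularUncountableCardinal : Set ℓ where
    field
      cardinal    : ∀ α → ¬ (K ↣ Seg α)
      regular     : ∀ δ → ¬ CofinalMap δ (U {A = K})
      uncountable : ¬ (K ↣ ℕ)

  IsSup : Pred K ℓ → Pred K ℓ
  IsSup X σ =
    (∀ {β} → β ∈ X → β ≤ σ) × (∀ τ → (∀ {β} → β ∈ X → β ≤ τ) → σ ≤ τ)

  IsAccPoint : Pred K ℓ → Pred K ℓ
  IsAccPoint X γ = Positive γ × IsSup (X ∩ (_< γ)) γ

  acc : Pred K ℓ → Pred K ℓ
  acc X = X ∩ IsAccPoint X

  IsClubIn : ∀ {p} → Pred K p → Pred K ℓ → Set _
  IsClubIn P D = CofinalIn P D × (∀ γ → γ ∈ P → IsAccPoint D γ → γ ∈ D)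

  IsStationary : Pred K ℓ → Set (suc ℓ)
  IsStationary S = ∀ D → IsClubIn (U {A = K}) D → Satisfiable (D ∩ S)

  ◇ : Set (suc ℓ)
  ◇ = Σ[ Z ∈ (K → Pred K ℓ) ]
    ((∀ α → Z α ⊆ (_< α)) ×
     (∀ (A : Pred K ℓ) → IsStationary (λ α → A ∩ (_< α) ≐ Z α)))

  -- otp(D ∩ δ) is the γ with OrderType … γ.
  succω : Pred K ℓ → Pred K ℓ
  succω D δ = δ ∈ D ×
    ∃[ γ ] (OrderType (κ-order ↾ (D ∩ (_< δ))) γ × Positive γ × γ <ω)

  -- The principle P₁₄(κ, ⊑, κ, {S}).  The difference of C α and the ordinal
  -- β = {γ | γ < β} is C α ∩ (β ≤_).
  P₁₄ : Pred K ℓ → Set (suc ℓ)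
  P₁₄ S = ◇ × Σ[ C ∈ (K → Pred K ℓ) ]
    ((∀ α → IsLimit α → IsClubIn (_< α) (C α)) ×
     (∀ α ᾱ → ᾱ ∈ acc (C α) → C ᾱ ≐ C α ∩ (_< ᾱ)) ×
     (∀ (A : K → Pred K ℓ) → (∀ i → CofinalIn (U {A = K}) (A i)) →
        IsStationary (λ α → α ∈ S × (∀ i → i < α →
          IsSup (λ β → β ∈ C α × succω (C α ∩ (β ≤_)) ⊆ A i) α))))

  -- `Height P x α` says that the set of predecessors of x has order type α.
  Height : (P : SPO) → ∥ P ∥ → K → Set ℓ
  Height P x α = OrderType (P ↾ (λ y → StrictPartialOrder._<_ P y x)) α

  levelOf : SPO → K → Setoid ℓ ℓ
  levelOf P α = StrictPartialOrder.Eq.setoid (P ↾ (λ x → Height P x α))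

  record IsSouslin (P : SPO) : Set (suc ℓ) where
    open StrictPartialOrder P using (_≈_) renaming (_<_ to _≺_)
    field
      -- Predecessor sets are well-ordered, in types < κ; so P is a tree of
      -- height at most κ.
      heights      : ∀ x → ∃[ α ] Height P x α
      height-κ     : ∀ α → ∃[ x ] Height P x α
      small-levels : ∀ α → ∣ levelOf P α ∣<κ
      -- A cofinal branch is a chain meeting every level.
      no-branch    : ¬ (Σ[ B ∈ Pred ∥ P ∥ ℓ ]
                         ((∀ {x y} → x ∈ B → y ∈ B → x ≺ y ⊎ x ≈ y ⊎ y ≺ x) ×
                          (∀ α → ∃[ x ] (x ∈ B × Height P x α))))
      -- An antichain of size κ, given by its one-to-one enumeration.
      no-antichain : ¬ (Σ[ a ∈ (K → ∥ P ∥) ]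
                         (Injective _≡_ _≈_ a ×
                          (∀ i j → ¬ (i ≡ j) → ¬ (a i ≺ a j))))

  record Node : Set ℓ where
    constructor node
    field
      dom : K
      fun : Seg dom → K
  open Node public

  -- A node is identified with its graph: equality, inclusion and proper
  -- inclusion of nodes are those of graphs.
  graph : Node → Pred (K × K) ℓ
  graph x (i , j) = Σ[ p ∈ i < dom x ] fun x (i , [ p ]) ≡ j

  nodes : SPO
  nodes = On.strictPartialOrder {B = Node} (⊂-strictPartialOrder (K × K) ℓ) graph

  open StrictPartialOrder nodes public using ()
    renaming (_≈_ to _≈ₙ_; _<_ to _⊊_)

  infix 4 _⊑_
  _⊑_ : Rel Node ℓ
  x ⊑ y = graph x ⊆ graph y

  -- μ^{<χ} < κ: as μ, χ < κ, the set ^{<χ}μ is a subset of ^{<κ}κ.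
  Power<κ : K → K → Set ℓ
  Power<κ μ χ = ∣ StrictPartialOrder.Eq.setoid
    (nodes ↾ (λ x → dom x < χ × (∀ i → fun x i < μ))) ∣<κ

  DownwardClosed : Pred Node ℓ → Set ℓ
  DownwardClosed T = ∀ x y → x ⊑ y → y ∈ T → x ∈ T

  -- i < max{ω, α} is rendered as i < ω or i < α.
  Prolific : Pred Node ℓ → Set ℓ
  Prolific T = ∀ x → x ∈ T → ∀ i → (i <ω ⊎ i < dom x) →
    ∃[ y ] (y ∈ T × graph y ≐ graph x ∪ ｛ (dom x , i) ｝)

  -- |T_α| ≤ max{|α|, ℵ₀}: at most |α| or at most ℵ₀.
  Slim : Pred Node ℓ → Set ℓ
  Slim T = ∀ α → ∣ level α ∣≤ α ⊎ ∣ level α ∣≤ℵ₀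
    where
    level : K → Setoid ℓ ℓ
    level α = StrictPartialOrder.Eq.setoid (nodes ↾ (λ x → x ∈ T × dom x ≡ α))

  module _ (T : Pred Node ℓ) {τ : K} (0<τ : Positive τ) (w : Seg τ → Node) where

    IsDerivedNode : Pred (Seg τ → Node) ℓ
    IsDerivedNode f =
      (∀ i → f i ∈ T) ×
      (∀ i j → dom (f i) ≡ dom (f j)) ×
      (∀ i → f i ⊑ w i ⊎ w i ⊑ f i)

    derivedTree : SPO
    derivedTree = record
      { Carrier = ∃ IsDerivedNode
      ; _≈_     = λ (f , _) (g , _) → ∀ i → f i ≈ₙ g i
      ; _<_     = λ (f , _) (g , _) → ∀ i → f i ⊊ g i
      ; isStrictPartialOrder = record
        { isEquivalence = record
          { refl  = λ {(f , _)} i → N.Eq.refl {f i}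
          ; sym   = λ {(f , _)} {(g , _)} p i → N.Eq.sym {f i} {g i} (p i)
          ; trans = λ {(f , _)} {(g , _)} {(h , _)} p q i →
                      N.Eq.trans {f i} {g i} {h i} (p i) (q i)
          }
        ; irrefl  = λ {(f , _)} {(g , _)} p q →
                      N.irrefl {f i₀} {g i₀} (p i₀) (q i₀)
        ; trans   = λ {(f , _)} {(g , _)} {(h , _)} p q i →
                      N.trans {f i} {g i} {h i} (p i) (q i)
        ; <-resp-≈ =
            (λ {(f , _)} {(g , _)} {(h , _)} p q i →
               N.<-respʳ-≈ {f i} {g i} {h i} (p i) (q i)) ,
            (λ {(f , _)} {(g , _)} {(h , _)} p q i →
               N.<-respˡ-≈ {f i} {g i} {h i} (p i) (q i))
        }
      }
      where
      module N = StrictPartialOrder nodes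
      i₀ : Seg τ
      i₀ = proj₁ 0<τ , [ proj₂ 0<τ ]

  Free : K → Pred Node ℓ → Set (suc ℓ)
  Free χ T = ∀ τ (0<τ : Positive τ) → τ < χ →
    ∀ β (w : Seg τ → Node) → (∀ i → w i ∈ T × dom (w i) ≡ β) →
    Injective _≡_ _≈ₙ_ w → IsSouslin (derivedTree T 0<τ w)

{-# OPTIONS --safe #-}
module Submission where

-- At a limit α, each node x of height in C α is continued to a cofinal branch
-- through the levels below α, and the level α consists of these branches.  The
-- continuation from one point γ of C α to the next point β depends only on
-- C α ∩ (β + 1), so by coherence of the C α the branches pass through the
-- levels built before.  Normally it is arbitrary; but if the set guessed by ◇
-- at β names a sequence of fewer than χ nodes, among them x, and a subset of a
-- derived tree, the continuations of all these nodes are extended together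
-- above an element of that subset, if possible.
--
-- Let D be a dense open subset of a derived tree.  Apply P₁₄ to the sets A i of
-- those β at which ◇ guesses D and the i-th sequence of nodes.  At the
-- resulting α, an element of the derived tree of height α consists of the
-- branches from a sequence of nodes, whose heights are bounded below α as
-- cf(α) ≥ χ, and so it was extended into D at some β < α.  Hence D contains the
-- whole level α.  For an antichain take D to be the elements above one of its
-- elements or incompatible with all of them; for a cofinal branch take its
-- complement.
--
-- Nodes of height δ are handled as functions on all of κ, up to agreement
-- below δ, so that restriction to a smaller height does not change a node.

open import Defs
open import Axiom.ExcludedMiddle using (ExcludedMiddle)
open import Data.Bool.Base using (Bool; true; false)
open import Data.Empty using (⊥; ⊥-elim; ⊥-elim-irr)
open import Data.Fin.Base using (Fin; toℕ; fromℕ<; combine)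
import Data.Fin.Properties as Fin
open import Data.Irrelevant using ([_])
open import Data.Nat.Base as ℕ using (ℕ)
import Data.Nat.Properties as ℕ
open import Data.Product using (Σ-syntax; ∃; ∃-syntax; _×_; _,_; proj₁; proj₂)
import Data.Product.Relation.Binary.Lex.Strict as Lex
open import Data.Product.Properties using (,-injective)
open import Data.Refinement using (value; _,_)
open import Data.Sum using (_⊎_; inj₁; inj₂)
open import Function
  using (_↣_; _↔_; mk↣; mk↔ₛ′; Injective; Injection; Inverse; _∘_; _on_)
open import Function.Construct.Composition using (injection; _↣-∘_)
open import Function.Properties.Inverse using (↔⇒↣)
open import Induction.WellFounded using (WellFounded; Acc; module Acc; module All)
open import Level using (Level; Lift; lift; lower; 0ℓ; suc)
open import Relation.Binary
  using (IsStrictTotalOrder; Rel; Setoid; StrictPartialOrder; tri<; tri≈; tri>)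
import Relation.Binary.Construct.On as On
open import Relation.Binary.Morphism.Structures using (IsOrderIsomorphism)
open import Relation.Binary.PropositionalEquality
  using (_≡_; _≢_; refl; sym; trans; cong; cong₂; subst; subst₂)
open import Relation.Nullary using (¬_; Dec; yes; no; does)
open import Relation.Unary using (Pred; U; _≐_; _∩_; _∈_)

module ClassicalOrdinal {ℓ : Level} (em : ExcludedMiddle (suc ℓ)) (κ : Ordinal ℓ) where

  open OnOrdinal κ public

  module STO = IsStrictTotalOrder (Ordinal.isStrictTotalOrder κ)
  open STO public using (compare) renaming (trans to <-trans)

  abstract
    dec : (P : Set ℓ) → Dec P
    dec P with em {Lift (suc ℓ) P}
    ... | yes p = yes (lower p)
    ... | no ¬p = no (λ p → ¬p (lift p))

  dne : {P : Set ℓ} → ¬ ¬ P → P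
  dne {P} ¬¬p with dec P
  ... | yes p = p
  ... | no ¬p = ⊥-elim (¬¬p ¬p)

  <-irrefl : ∀ {a} → ¬ a < a
  <-irrefl = STO.irrefl refl

  ≤-refl : ∀ {a} → a ≤ a
  ≤-refl = inj₂ refl

  <⇒≤ : ∀ {a b} → a < b → a ≤ b
  <⇒≤ = inj₁

  ≤-<-trans : ∀ {a b c} → a ≤ b → b < c → a < c
  ≤-<-trans (inj₁ p) q = <-trans p q
  ≤-<-trans (inj₂ refl) q = q

  <-≤-trans : ∀ {a b c} → a < b → b ≤ c → a < c
  <-≤-trans p (inj₁ q) = <-trans p q
  <-≤-trans p (inj₂ refl) = p

  ≤-trans : ∀ {a b c} → a ≤ b → b ≤ c → a ≤ c
  ≤-trans p (inj₁ q) = inj₁ (≤-<-trans p q)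
  ≤-trans p (inj₂ refl) = p

  <⇒≱ : ∀ {a b} → a < b → ¬ b ≤ a
  <⇒≱ p q = <-irrefl (<-≤-trans p q)

  ≤-antisym : ∀ {a b} → a ≤ b → b ≤ a → a ≡ b
  ≤-antisym (inj₂ p) _ = p
  ≤-antisym (inj₁ p) q = ⊥-elim (<⇒≱ p q)

  ≮⇒≥ : ∀ {a b} → ¬ a < b → b ≤ a
  ≮⇒≥ {a} {b} ¬p with compare a b
  ... | tri< p _ _ = ⊥-elim (¬p p)
  ... | tri≈ _ p _ = inj₂ (sym p)
  ... | tri> _ _ p = inj₁ p

  ≰⇒> : ∀ {a b} → ¬ a ≤ b → b < a
  ≰⇒> {a} {b} ¬p with compare a b
  ... | tri< p _ _ = ⊥-elim (¬p (inj₁ p))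
  ... | tri≈ _ p _ = ⊥-elim (¬p (inj₂ p))
  ... | tri> _ _ p = p

  <-or-≥ : ∀ a b → a < b ⊎ b ≤ a
  <-or-≥ a b with compare a b
  ... | tri< p _ _ = inj₁ p
  ... | tri≈ _ p _ = inj₂ (inj₂ (sym p))
  ... | tri> _ _ p = inj₂ (inj₁ p)

  wfInd : ∀ {p} (P : K → Set p) → (∀ a → (∀ b → b < a → P b) → P a) → ∀ a → P a
  wfInd P step = All.wfRec (Ordinal.wellFounded κ) _ P (λ a h → step a (λ b p → h p))

  minimal : (P : Pred K ℓ) → ∃ P → ∃[ m ] (P m × (∀ v → P v → m ≤ v))
  minimal P (a , pa) = wfInd (λ a → P a → ∃[ m ] (P m × (∀ v → P v → m ≤ v))) step a pa
    where
    step : ∀ a → (∀ b → b < a → P b → _) → P a → ∃[ m ] (P m × (∀ v → P v → m ≤ v))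
    step a ih pa with dec (∃[ b ] (b < a × P b))
    ... | yes (b , b<a , pb) = ih b b<a pb
    ... | no ¬b = a , pa , λ v pv → ≮⇒≥ λ v<a → ¬b (v , v<a , pv)

  _⊔_ : K → K → K
  a ⊔ b with <-or-≥ a b
  ... | inj₁ _ = b
  ... | inj₂ _ = a

  a≤a⊔b : ∀ a b → a ≤ (a ⊔ b)
  a≤a⊔b a b with <-or-≥ a b
  ... | inj₁ p = inj₁ p
  ... | inj₂ _ = ≤-refl

  b≤a⊔b : ∀ a b → b ≤ (a ⊔ b)
  b≤a⊔b a b with <-or-≥ a b
  ... | inj₁ p = ≤-refl
  ... | inj₂ p = p

  ⊔-lub : ∀ {a b c} → a ≤ c → b ≤ c → (a ⊔ b) ≤ c
  ⊔-lub {a} {b} p q with <-or-≥ a b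
  ... | inj₁ _ = q
  ... | inj₂ _ = p

  ⊔-lub< : ∀ {a b c} → a < c → b < c → (a ⊔ b) < c
  ⊔-lub< {a} {b} p q with <-or-≥ a b
  ... | inj₁ _ = q
  ... | inj₂ _ = p

  segOut : ∀ {α} (i : Seg α) → value i < α
  segOut {α} (i , [ p ]) with dec (i < α)
  ... | yes q = q
  ... | no ¬q = ⊥-elim-irr (¬q p)

  seg≡ : ∀ {α} {i j : Seg α} → value i ≡ value j → i ≡ j
  seg≡ refl = refl

  -- Recursion along a well-founded relation whose step function only respects
  -- pointwise equality of the recursive values, as there is no function
  -- extensionality.
  module Recursion {i v} {A : Set ℓ} {I : Set i} {V : Set v} {_≺_ : Rel A ℓ} (wf : WellFounded _≺_) (v₀ : V)
    (step : A → (A → I → V) → I → V)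
    (step-cong : ∀ a g h → (∀ b → b ≺ a → ∀ i → g b i ≡ h b i) → ∀ i → step a g i ≡ step a h i)
    where

    cut : (a : A) → (∀ {b} → b ≺ a → I → V) → A → I → V
    cut a g b i with dec (b ≺ a)
    ... | yes p = g p i
    ... | no _ = v₀

    recAcc : ∀ a → Acc _≺_ a → I → V
    recAcc a (Acc.acc rs) = step a (cut a (λ {b} p → recAcc b (rs p)))

    recAcc-irr : ∀ a (p q : Acc _≺_ a) i → recAcc a p i ≡ recAcc a q i
    recAcc-irr a (Acc.acc rs) (Acc.acc ss) = step-cong a _ _ lem
      where
      lem : ∀ b → b ≺ a → ∀ i →
        cut a (λ {b} p → recAcc b (rs p)) b i ≡ cut a (λ {b} p → recAcc b (ss p)) b i
      lem b _ i with dec (b ≺ a)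
      ... | yes p = recAcc-irr b (rs p) (ss p) i
      ... | no _ = refl

    abstract
      rec : A → I → V
      rec a = recAcc a (wf a)

      rec-eq : ∀ a i → rec a i ≡ step a rec i
      rec-eq a i with wf a
      ... | Acc.acc rs = step-cong a _ _ lem i
        where
        lem : ∀ b → b ≺ a → ∀ i → cut a (λ {b} p → recAcc b (rs p)) b i ≡ rec b i
        lem b b≺a i with dec (b ≺ a)
        ... | yes p = recAcc-irr b (rs p) (wf b) i
        ... | no ¬p = ⊥-elim (¬p b≺a)

  below : ∀ {α} a → a < α → Seg α
  below a p = a , [ p ]

  Seg↣ : ∀ {b} {B : Set b} {α} (f : ∀ a → a < α → B) →
    (∀ {a b} (p : a < α) (q : b < α) → f a p ≡ f b q → a ≡ b) → Seg α ↣ B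
  Seg↣ f inj = mk↣ {to = λ i → f (value i) (segOut i)}
    λ {i} {j} e → seg≡ (inj (segOut i) (segOut j) e)

module RegularCardinal {ℓ : Level} (em : ExcludedMiddle (suc ℓ)) (κ : Ordinal ℓ)
  (reg : OnOrdinal.IsRegularUncountableCardinal κ) where

  open ClassicalOrdinal em κ public

  open IsRegularUncountableCardinal reg

  inhabitant : K
  inhabitant with dec K
  ... | yes k = k
  ... | no ¬k = ⊥-elim (uncountable (mk↣ {to = λ k → ⊥-elim (¬k k)} λ {k} _ → ⊥-elim (¬k k)))

  abstract
    𝟎 : K
    𝟎 = proj₁ (minimal (λ k → k ≡ k) (inhabitant , refl))

    𝟎≤ : ∀ k → 𝟎 ≤ k
    𝟎≤ k = proj₂ (proj₂ (minimal (λ k → k ≡ k) (inhabitant , refl))) k refl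

  ≮𝟎 : ∀ {k} → ¬ k < 𝟎
  ≮𝟎 p = <⇒≱ p (𝟎≤ _)

  -- `least P` is 𝟎 if P is empty.
  abstract
    least : Pred K ℓ → K
    least P with dec (∃ P)
    ... | yes e = proj₁ (minimal P e)
    ... | no _ = 𝟎

    least-sat : ∀ (P : Pred K ℓ) {v} → P v → P (least P)
    least-sat P {v} pv with dec (∃ P)
    ... | yes e = proj₁ (proj₂ (minimal P e))
    ... | no ¬e = ⊥-elim (¬e (v , pv))

    least-min : ∀ (P : Pred K ℓ) {v} → P v → least P ≤ v
    least-min P {v} pv with dec (∃ P)
    ... | yes e = proj₂ (proj₂ (minimal P e)) v pv
    ... | no ¬e = ⊥-elim (¬e (v , pv))

    least-≤ : ∀ (P : Pred K ℓ) {b} → (∀ v → P v → v ≤ b) → least P ≤ b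
    least-≤ P h with dec (∃ P)
    ... | yes e = h _ (proj₁ (proj₂ (minimal P e)))
    ... | no _ = 𝟎≤ _

    least-cong : ∀ {P Q : Pred K ℓ} → (∀ v → P v → Q v) → (∀ v → Q v → P v) → least P ≡ least Q
    least-cong {P} {Q} f g with dec (∃ P) | dec (∃ Q)
    ... | no _ | no _ = refl
    ... | yes (v , pv) | no ¬q = ⊥-elim (¬q (v , f v pv))
    ... | no ¬p | yes (v , qv) = ⊥-elim (¬p (v , g v qv))
    ... | yes p | yes q =
      let (a , pa , am) = minimal P p
          (b , qb , bm) = minimal Q q
      in ≤-antisym (am b (g b qb)) (bm a (f a pa))

  least-unique : ∀ (P : Pred K ℓ) {v} → P v → (∀ u → P u → u ≡ v) → least P ≡ v
  least-unique P pv h = h _ (least-sat P pv)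

  abstract
    bound : (δ : K) (f : K → K) → ∃[ β ] (∀ i → i < δ → f i < β)
    bound δ f = dne λ ¬b → regular δ (f ∘ value , (λ _ → _) , λ β _ → dne λ ¬i →
      ¬b (β , λ i i<δ → ≰⇒> λ β≤fi → ¬i ((i , [ i<δ ]) , β≤fi)))

    bound₂ : (δ ε : K) (f : K → K → K) → ∃[ β ] (∀ i j → i < δ → j < ε → f i j < β)
    bound₂ δ ε f =
      let (β , h) = bound δ (λ i → proj₁ (bound ε (f i)))
      in β , λ i j i<δ j<ε → <-trans (proj₂ (bound ε (f i)) j j<ε) (h i i<δ)

    ∃-above : ∀ a → ∃[ b ] a < b
    ∃-above a with dec (∃[ k ] 𝟎 < k)
    ... | yes (k , p) = let (β , h) = bound k (λ _ → a) in β , h 𝟎 p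
    ... | no ¬p = ⊥-elim (uncountable (mk↣ {to = λ _ → 0} λ {x} {y} _ →
            trans (is𝟎 x) (sym (is𝟎 y))))
      where
      is𝟎 : ∀ k → k ≡ 𝟎
      is𝟎 k = ≤-antisym (≮⇒≥ λ q → ¬p (k , q)) (𝟎≤ k)

    S : K → K
    S a = least (a <_)

    <S : ∀ {a} → a < S a
    <S {a} = least-sat (a <_) (proj₂ (∃-above a))

    S-least : ∀ {a b} → a < b → S a ≤ b
    S-least {a} p = least-min (a <_) p

  <S⇒≤ : ∀ {a b} → a < S b → a ≤ b
  <S⇒≤ p = ≮⇒≥ λ q → <⇒≱ p (S-least q)

  ≤⇒<S : ∀ {a b} → a ≤ b → a < S b
  ≤⇒<S p = ≤-<-trans p <S

  S-injective : ∀ {a b} → S a ≡ S b → a ≡ b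
  S-injective {a} {b} e = ≤-antisym (<S⇒≤ (subst (a <_) e <S)) (<S⇒≤ (subst (b <_) (sym e) <S))

  IsLimit-S : ∀ {a b} → IsLimit a → b < a → S b < a
  IsLimit-S (_ , h) b<a = let (c , b<c , c<a) = h _ b<a in ≤-<-trans (S-least b<c) c<a

  cases : ∀ α → (α ≡ 𝟎) ⊎ (∃[ β ] α ≡ S β) ⊎ IsLimit α
  cases α with dec (α ≡ 𝟎)
  ... | yes p = inj₁ p
  ... | no p with dec (∃[ β ] α ≡ S β)
  ... | yes q = inj₂ (inj₁ q)
  ... | no q = inj₂ (inj₂ ((𝟎 , pos) , lim))
    where
    pos : 𝟎 < α
    pos with 𝟎≤ α
    ... | inj₁ r = r
    ... | inj₂ r = ⊥-elim (p (sym r))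
    lim : ∀ β → β < α → ∃[ γ ] (β < γ × γ < α)
    lim β β<α with S-least β<α
    ... | inj₁ r = S β , <S , r
    ... | inj₂ r = ⊥-elim (q (β , sym r))

  IsLimit⇒≢𝟎 : ∀ {α} → IsLimit α → α ≢ 𝟎
  IsLimit⇒≢𝟎 ((_ , p) , _) refl = ≮𝟎 p

  IsLimit⇒≢S : ∀ {α β} → IsLimit α → α ≢ S β
  IsLimit⇒≢S (_ , h) refl = let (_ , p , q) = h _ <S in <⇒≱ q (S-least p)

  𝟎≢S : ∀ {β} → 𝟎 ≢ S β
  𝟎≢S {β} e = ≮𝟎 (subst (β <_) (sym e) <S)

  -- Finite ordinals

  num : ℕ → K
  num ℕ.zero = 𝟎
  num (ℕ.suc n) = S (num n)

  num-mono : ∀ {m n} → m ℕ.< n → num m < num n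
  num-mono {m} {ℕ.suc n} (ℕ.s≤s m≤n) with ℕ.m≤n⇒m<n∨m≡n m≤n
  ... | inj₁ m<n = <-trans (num-mono m<n) <S
  ... | inj₂ refl = <S

  num-injective : ∀ {m n} → num m ≡ num n → m ≡ n
  num-injective {m} {n} e with ℕ.<-cmp m n
  ... | tri< p _ _ = ⊥-elim (<-irrefl (subst (_< num n) e (num-mono p)))
  ... | tri≈ _ p _ = p
  ... | tri> _ _ p = ⊥-elim (<-irrefl (subst (num n <_) e (num-mono p)))

  <num⇒num : ∀ n {k} → k < num n → ∃[ m ] (m ℕ.< n × k ≡ num m)
  <num⇒num ℕ.zero p = ⊥-elim (≮𝟎 p)
  <num⇒num (ℕ.suc n) p with <S⇒≤ p
  ... | inj₂ e = n , ℕ.n<1+n n , e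
  ... | inj₁ q = let (m , m<n , e) = <num⇒num n q in m , ℕ.m<n⇒m<1+n m<n , e

  Seg-num : ∀ n → Seg (num n) ↔ Fin n
  Seg-num n = mk↔ₛ′ to from
    (λ i → Fin.toℕ-injective (num-injective (trans (sym (to-spec (from i))) refl)))
    (λ i → seg≡ (sym (to-spec i)))
    where
    to : Seg (num n) → Fin n
    to i = let (m , m<n , _) = <num⇒num n (segOut i) in fromℕ< m<n
    from : Fin n → Seg (num n)
    from i = num (toℕ i) , [ num-mono (Fin.toℕ<n i) ]
    to-spec : ∀ i → value i ≡ num (toℕ (to i))
    to-spec i = let (m , m<n , e) = <num⇒num n (segOut i)
                in trans e (cong num (sym (Fin.toℕ-fromℕ< m<n)))

  num<ω : ∀ n → num n <ω
  num<ω n = n , Seg-num n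

  ¬Seg↣Fin : ∀ n {α} → num n < α → ¬ (Seg α ↣ Fin n)
  ¬Seg↣Fin n {α} p f = ℕ.<-irrefl refl (Fin.injective⇒≤ {f = g} g-inj)
    where
    g : Fin (ℕ.suc n) → Fin n
    g i = Injection.to f (num (toℕ i) , [ ≤-<-trans (num-≤ i) p ])
      where
      num-≤ : ∀ i → num (toℕ {ℕ.suc n} i) ≤ num n
      num-≤ i = <S⇒≤ (num-mono (Fin.toℕ<n i))
    g-inj : Injective _≡_ _≡_ g
    g-inj e = Fin.toℕ-injective (num-injective (cong value (Injection.injective f e)))

  <ω⇒num : ∀ {γ} → (f : γ <ω) → γ ≡ num (proj₁ f)
  <ω⇒num {γ} (n , f) with compare γ (num n)
  ... | tri≈ _ e _ = e
  ... | tri> _ _ p = ⊥-elim (¬Seg↣Fin n p (↔⇒↣ f))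
  ... | tri< p _ _ with <num⇒num n p
  ... | (m , m<n , refl) = ⊥-elim (ℕ.<-irrefl refl (ℕ.<-≤-trans m<n
          (Fin.injective⇒≤ {f = Inverse.to (Seg-num m) ∘ Inverse.from f}
            (λ e → inv-inj (Injection.injective (↔⇒↣ (Seg-num m)) e)))))
    where
    inv-inj : ∀ {i j} → Inverse.from f i ≡ Inverse.from f j → i ≡ j
    inv-inj {i} {j} e = trans (sym (Inverse.strictlyInverseˡ f i))
      (trans (cong (Inverse.to f) e) (Inverse.strictlyInverseˡ f j))

  abstract
    ω-exists : ∃[ k ] (∀ n → k ≢ num n)
    ω-exists = dne λ ¬e →
      let h : ∀ k → ∃[ n ] k ≡ num n
          h k = dne λ ¬n → ¬e (k , λ n e → ¬n (n , e))
      in uncountable (mk↣ {to = proj₁ ∘ h} λ {x} {y} e →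
           trans (proj₂ (h x)) (trans (cong num e) (sym (proj₂ (h y)))))

    ω : K
    ω = least (λ k → ∀ n → k ≢ num n)

    ω≢num : ∀ n → ω ≢ num n
    ω≢num = least-sat (λ k → ∀ n → k ≢ num n) (proj₂ ω-exists)

    <ω̂⇒num : ∀ {k} → k < ω → ∃[ n ] k ≡ num n
    <ω̂⇒num {k} p = dne λ ¬n → <⇒≱ p (least-min (λ k → ∀ n → k ≢ num n) λ n e → ¬n (n , e))

  num<ω̂ : ∀ n → num n < ω
  num<ω̂ n with compare (num n) ω
  ... | tri< p _ _ = p
  ... | tri≈ _ p _ = ⊥-elim (ω≢num n (sym p))
  ... | tri> _ _ p = let (m , _ , e) = <num⇒num n p in ⊥-elim (ω≢num m e)

  <ω⇒<ω̂ : ∀ {γ} → γ <ω → γ < ω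
  <ω⇒<ω̂ p = subst (_< ω) (sym (<ω⇒num p)) (num<ω̂ (proj₁ p))

  Seg-ω↣ℕ : Seg ω ↣ ℕ
  Seg-ω↣ℕ = mk↣ {to = λ i → proj₁ (<ω̂⇒num (segOut i))} λ {x} {y} e →
    seg≡ (trans (proj₂ (<ω̂⇒num (segOut x))) (trans (cong num e) (sym (proj₂ (<ω̂⇒num (segOut y))))))

  bound-ℕ : (f : ℕ → K) → ∃[ β ] (∀ n → f n < β)
  bound-ℕ f = β , λ n → h n
    where
    g : K → K
    g k = f (index (dec (∃[ n ] k ≡ num n)))
      where
      index : ∀ {P : ℕ → Set ℓ} → Dec (∃ P) → ℕ
      index (yes (n , _)) = n
      index (no _) = 0
    g-num : ∀ n → g (num n) ≡ f n
    g-num n with dec (∃[ m ] num n ≡ num m)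
    ... | yes (m , e) = cong f (sym (num-injective e))
    ... | no ¬m = ⊥-elim (¬m (n , refl))
    β : K
    β = proj₁ (bound ω g)
    h : ∀ n → f n < β
    h n = subst (_< β) (g-num n) (proj₂ (bound ω g) (num n) (num<ω̂ n))

  -- Closure points

  Closed : (K → K) → Pred K ℓ
  Closed h α = IsLimit α × (∀ δ → δ < α → h δ < α)

  IsAccPoint-below : ∀ {X γ} → IsAccPoint X γ → ∀ {δ} → δ < γ → ∃[ ε ] (X ε × δ < ε × ε < γ)
  IsAccPoint-below {X} {γ} (_ , _ , lub) {δ} δ<γ = dne λ ¬ε →
    <⇒≱ δ<γ (lub δ λ { {β} (xβ , β<γ) → ≮⇒≥ λ δ<β → ¬ε (β , xβ , δ<β , β<γ) })

  Closed-club : ∀ h → IsClubIn {0ℓ} U (Closed h)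
  Closed-club h = ((λ _ → _) , λ β _ → cofinal β) , λ γ _ → closed γ
    where
    closed : ∀ γ → IsAccPoint (Closed h) γ → Closed h γ
    closed γ accγ@(pos , _) =
      (pos , λ β β<γ → let (ε , _ , p , q) = IsAccPoint-below accγ β<γ in ε , p , q) ,
      λ δ δ<γ → let (ε , (_ , c) , p , q) = IsAccPoint-below accγ δ<γ in <-trans (c δ p) q
    module _ (β : K) where
      next : K → K
      next k = S k ⊔ proj₁ (bound (S k) h)
      it : ℕ → K
      it ℕ.zero = β
      it (ℕ.suc n) = next (it n)
      it< : ∀ n → it n < it (ℕ.suc n)
      it< n = <-≤-trans <S (a≤a⊔b _ _)
      Above : Pred K ℓ
      Above k = ∀ n → it n < k
      α : K
      α = least Above
      it<α : Above α
      it<α = least-sat Above (proj₂ (bound-ℕ it))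
      below-it : ∀ {δ} → δ < α → ∃[ n ] δ ≤ it n
      below-it {δ} p = dne λ ¬n → <⇒≱ p (least-min Above λ n → ≰⇒> λ q → ¬n (n , q))
      cofinal : ∃[ α ] (Closed h α × β ≤ α)
      cofinal = α , (((β , it<α 0) , λ δ p → let (n , q) = below-it p in
          it (ℕ.suc n) , ≤-<-trans q (it< n) , it<α (ℕ.suc n)) ,
        λ δ p → let (n , q) = below-it p in
          <-trans (proj₂ (bound (S (it n)) h) δ (≤⇒<S q))
            (≤-<-trans (b≤a⊔b (S (it n)) _) (it<α (ℕ.suc n)))) ,
        inj₁ (it<α 0)

  _≺_ : Rel (K × K) ℓ
  _≺_ = Lex.×-Lex _≡_ _<_ (Lex.×-Lex _≡_ _<_ _<_) on λ (a , b) → (a ⊔ b) , a , b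

  ≺-wellFounded : WellFounded _≺_
  ≺-wellFounded = On.wellFounded (λ (a , b) → (a ⊔ b) , a , b)
    (Lex.×-wellFounded <-wf (Lex.×-wellFounded <-wf <-wf))
    where <-wf = Ordinal.wellFounded κ

  ≺-total : ∀ {p q} → p ≢ q → p ≺ q ⊎ q ≺ p
  ≺-total {a , b} {c , d} p≢q with compare (a ⊔ b) (c ⊔ d) | compare a c | compare b d
  ... | tri< p _ _ | _ | _ = inj₁ (inj₁ p)
  ... | tri> _ _ p | _ | _ = inj₂ (inj₁ p)
  ... | tri≈ _ e _ | tri< p _ _ | _ = inj₁ (inj₂ (e , inj₁ p))
  ... | tri≈ _ e _ | tri> _ _ p | _ = inj₂ (inj₂ (sym e , inj₁ p))
  ... | tri≈ _ e _ | tri≈ _ e′ _ | tri< p _ _ = inj₁ (inj₂ (e , inj₂ (e′ , p)))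
  ... | tri≈ _ e _ | tri≈ _ e′ _ | tri> _ _ p = inj₂ (inj₂ (sym e , inj₂ (sym e′ , p)))
  ... | tri≈ _ _ _ | tri≈ _ refl _ | tri≈ _ refl _ = ⊥-elim (p≢q refl)

  ≺⇒⊔≤ : ∀ {a b c d} → (a , b) ≺ (c , d) → (a ⊔ b) ≤ (c ⊔ d)
  ≺⇒⊔≤ (inj₁ p) = inj₁ p
  ≺⇒⊔≤ (inj₂ (e , _)) = inj₂ e

  record PairingOn (P : Pred K ℓ) : Set ℓ where
    field
      pair           : K → K → K
      pair-closed    : ∀ {a b} → P a → P b → P (pair a b)
      pair-injective : ∀ {a b c d} → P a → P b → P c → P d →
                       pair a b ≡ pair c d → a ≡ c × b ≡ d

  -- The Mostowski collapse of Gödel's well-order of pairs: a pair is sent to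
  -- the least ordinal that is not the image of a smaller pair.
  module Collapse (P : Pred K ℓ) (down : ∀ {u v} → P v → u ≤ v → P u)
    (room : ∀ {a b} → P a → P b → (g : K × K → K) →
      ∃[ v ] (P v × (∀ q → q ≺ (a , b) → g q ≢ v)))
    where

    Fresh : K × K → (K × K → K) → Pred K ℓ
    Fresh p g v = P v × (∀ q → q ≺ p → g q ≢ v)

    step : K × K → (K × K → K → K) → K → K
    step p g i = least (Fresh p (λ q → g q i))

    step-ext : ∀ p g h → (∀ q → q ≺ p → ∀ i → g q i ≡ h q i) → ∀ i → step p g i ≡ step p h i
    step-ext p g h e i = least-cong
      (λ v (pv , f) → pv , λ q q≺p → subst (_≢ v) (e q q≺p i) (f q q≺p))
      (λ v (pv , f) → pv , λ q q≺p → subst (_≢ v) (sym (e q q≺p i)) (f q q≺p))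

    open Recursion {I = K} ≺-wellFounded 𝟎 step step-ext

    rank : K × K → K
    rank p = rec p 𝟎

    fresh : ∀ {a b} → P a → P b → Fresh (a , b) rank (rank (a , b))
    fresh {a} {b} pa pb = subst (Fresh (a , b) rank) (sym (rec-eq (a , b) 𝟎))
      (least-sat (Fresh (a , b) rank) (proj₂ (room pa pb rank)))

    collapse : PairingOn P
    collapse = record
      { pair           = λ a b → rank (a , b)
      ; pair-closed    = λ pa pb → proj₁ (fresh pa pb)
      ; pair-injective = λ {a} {b} {c} {d} pa pb pc pd e →
          ,-injective (dne λ p≢q → case≢ pa pb pc pd e (≺-total p≢q))
      }
      where
      case≢ : ∀ {a b c d} → P a → P b → P c → P d → rank (a , b) ≡ rank (c , d) →
              (a , b) ≺ (c , d) ⊎ (c , d) ≺ (a , b) → ⊥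
      case≢ pa pb pc pd e (inj₁ q) = proj₂ (fresh pc pd) _ q e
      case≢ pa pb pc pd e (inj₂ q) = proj₂ (fresh pa pb) _ q (sym e)

  abstract
    pairingK : PairingOn (λ v → v ≡ v)
    pairingK = Collapse.collapse (λ v → v ≡ v) (λ _ _ → refl) room
      where
      room : ∀ {a b} → a ≡ a → b ≡ b → (g : K × K → K) →
        ∃[ v ] (v ≡ v × (∀ q → q ≺ (a , b) → g q ≢ v))
      room {a} {b} _ _ g =
        let (β , h) = bound₂ (S (a ⊔ b)) (S (a ⊔ b)) (λ c d → g (c , d))
        in β , refl , λ { (c , d) q e → <-irrefl (subst (_< β) e (h c d
             (≤⇒<S (≤-trans (a≤a⊔b c d) (≺⇒⊔≤ q)))
             (≤⇒<S (≤-trans (b≤a⊔b c d) (≺⇒⊔≤ q))))) }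

  Embeds : K → K → Set ℓ
  Embeds α β = Σ[ f ∈ (K → K) ] ((∀ a → a < α → f a < β) ×
    (∀ a b → a < α → b < α → f a ≡ f b → a ≡ b))

  Embeds⇒↣ : ∀ {α β} → Embeds α β → Seg α ↣ Seg β
  Embeds⇒↣ (f , into , inj) = Seg↣ (λ a p → below (f a) (into a p))
    λ p q e → inj _ _ p q (cong value e)

  ↣⇒Embeds : ∀ {α β} → Seg α ↣ Seg β → Embeds α β
  ↣⇒Embeds {α} {β} f = g , into , inj
    where
    g : K → K
    g a with dec (a < α)
    ... | yes p = value (Injection.to f (below a p))
    ... | no _ = 𝟎
    into : ∀ a → a < α → g a < β
    into a p with dec (a < α)
    ... | yes q = segOut (Injection.to f (below a q))
    ... | no ¬q = ⊥-elim (¬q p)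
    inj : ∀ a b → a < α → b < α → g a ≡ g b → a ≡ b
    inj a b p q e with dec (a < α) | dec (b < α)
    ... | yes p′ | yes q′ = cong value (Injection.injective f
      (seg≡ {i = Injection.to f (below a p′)} {j = Injection.to f (below b q′)} e))
    ... | no ¬p | _ = ⊥-elim (¬p p)
    ... | _ | no ¬q = ⊥-elim (¬q q)

  no-finite-square : ∀ {α} n → ω ≤ α → ¬ (Seg α ↣ (Fin n × Fin n))
  no-finite-square {α} n ω≤α f = ¬Seg↣Fin (n ℕ.* n) (<-≤-trans (num<ω̂ (n ℕ.* n)) ω≤α)
    (mk↣ {to = λ i → combine (proj₁ (to i)) (proj₂ (to i))} λ {i} {j} e →
      injective (cong₂ _,_
        (Fin.combine-injectiveˡ (proj₁ (to i)) (proj₂ (to i)) (proj₁ (to j)) (proj₂ (to j)) e)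
        (Fin.combine-injectiveʳ (proj₁ (to i)) (proj₂ (to i)) (proj₁ (to j)) (proj₂ (to j)) e)))
    where open Injection f

  module _ {m} (ω≤m : ω ≤ m) (pm : PairingOn (_< m)) where
    open PairingOn pm

    private
      𝟎<m : 𝟎 < m
      𝟎<m = <-≤-trans (num<ω̂ 0) ω≤m
      𝟏<m : num 1 < m
      𝟏<m = <-≤-trans (num<ω̂ 1) ω≤m

    shift : K → K
    shift x with dec (x < m)
    ... | yes _ = pair x 𝟎
    ... | no _ = pair 𝟎 (num 1)

    shift-< : ∀ {x} → shift x < m
    shift-< {x} with dec (x < m)
    ... | yes p = pair-closed p 𝟎<m
    ... | no _ = pair-closed 𝟎<m 𝟏<m

    shift-injective : ∀ {x y} → x ≤ m → y ≤ m → shift x ≡ shift y → x ≡ y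
    shift-injective {x} {y} x≤ y≤ e with dec (x < m) | dec (y < m)
    ... | yes p | yes q = proj₁ (pair-injective p 𝟎<m q 𝟎<m e)
    ... | yes p | no _ = ⊥-elim (𝟎≢S (proj₂ (pair-injective p 𝟎<m 𝟎<m 𝟏<m e)))
    ... | no _ | yes q = ⊥-elim (𝟎≢S (sym (proj₂ (pair-injective 𝟎<m 𝟏<m q 𝟎<m e))))
    ... | no p | no q = trans (≤-antisym x≤ (≮⇒≥ p)) (sym (≤-antisym y≤ (≮⇒≥ q)))

  abstract
    hessenberg : ∀ α → ω ≤ α → PairingOn (_< α)
    hessenberg = wfInd (λ α → ω ≤ α → PairingOn (_< α)) step
      where
      step : ∀ α → (∀ β → β < α → ω ≤ β → PairingOn (_< β)) → ω ≤ α → PairingOn (_< α)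
      step α ih ω≤α with dec (∃[ β ] (β < α × Embeds α β))
      ... | yes (β , β<α , emb@(f , into , inj)) = record
        { pair           = λ a b → pair (f a) (f b)
        ; pair-closed    = λ p q → <-trans (pair-closed (into _ p) (into _ q)) β<α
        ; pair-injective = λ p q r s e →
            let (e₁ , e₂) = pair-injective (into _ p) (into _ q) (into _ r) (into _ s) e
            in inj _ _ p r e₁ , inj _ _ q s e₂
        }
        where
        ω≤β : ω ≤ β
        ω≤β = ≮⇒≥ λ β<ω → let (n , e) = <ω̂⇒num β<ω in
          ¬Seg↣Fin n (subst (_< α) e β<α)
            (↔⇒↣ (Seg-num n) ↣-∘ Embeds⇒↣ (subst (Embeds α) e emb))
        open PairingOn (ih β β<α ω≤β)
      ... | no cardinal-α = Collapse.collapse (_< α) (λ v<α u≤v → ≤-<-trans u≤v v<α) room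
        where
        room : ∀ {a b} → a < α → b < α → (g : K × K → K) →
          ∃[ v ] (v < α × (∀ q → q ≺ (a , b) → g q ≢ v))
        room {a} {b} a<α b<α g = dne λ ¬v → contra λ v v<α → dne λ ¬q →
          ¬v (v , v<α , λ q q≺ e → ¬q (q , q≺ , e))
          where
          m : K
          m = a ⊔ b
          contra : ¬ (∀ v → v < α → ∃[ q ] (q ≺ (a , b) × g q ≡ v))
          contra h = split (<-or-≥ m ω)
            where
            q : Seg α → K × K
            q i = proj₁ (h (value i) (segOut i))
            q-inj : ∀ {i j} → q i ≡ q j → i ≡ j
            q-inj {i} {j} e = seg≡ (trans (sym (proj₂ (proj₂ (h (value i) (segOut i)))))
              (trans (cong g e) (proj₂ (proj₂ (h (value j) (segOut j))))))
            q₁≤ : ∀ i → proj₁ (q i) ≤ m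
            q₁≤ i = ≤-trans (a≤a⊔b _ _) (≺⇒⊔≤ (proj₁ (proj₂ (h (value i) (segOut i)))))
            q₂≤ : ∀ i → proj₂ (q i) ≤ m
            q₂≤ i = ≤-trans (b≤a⊔b _ _) (≺⇒⊔≤ (proj₁ (proj₂ (h (value i) (segOut i)))))
            split : m < ω ⊎ ω ≤ m → ⊥
            split (inj₁ m<ω) = let (n , e) = <ω̂⇒num m<ω in finite n e
              where
              finite : ∀ n → m ≡ num n → ⊥
              finite n e = no-finite-square (ℕ.suc n) ω≤α (mk↣
                {to = λ i → code (q₁≤ i) , code (q₂≤ i)}
                λ {i} {j} ε → q-inj (cong₂ _,_
                  (code-inj (q₁≤ i) (q₁≤ j) (proj₁ (,-injective ε)))
                  (code-inj (q₂≤ i) (q₂≤ j) (proj₂ (,-injective ε)))))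
                where
                seg-of : ∀ {c} → c ≤ m → Seg (num (ℕ.suc n))
                seg-of {c} c≤m = below c (subst (λ k → c < S k) e (≤⇒<S c≤m))
                code : ∀ {c} → c ≤ m → Fin (ℕ.suc n)
                code {c} c≤m = Injection.to (↔⇒↣ (Seg-num (ℕ.suc n))) (seg-of c≤m)
                code-inj : ∀ {c d} (p : c ≤ m) (q : d ≤ m) → code p ≡ code q → c ≡ d
                code-inj p q ε = cong value
                  (Injection.injective (↔⇒↣ (Seg-num (ℕ.suc n))) {x = seg-of p} {y = seg-of q} ε)
            split (inj₂ ω≤m) = cardinal-α (m , m<α , ↣⇒Embeds (mk↣
              {to = λ i → below (pair (σ (proj₁ (q i))) (σ (proj₂ (q i))))
                (pair-closed (shift-< ω≤m pm) (shift-< ω≤m pm))}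
              λ {i} {j} ε → let (e₁ , e₂) = pair-injective (shift-< ω≤m pm) (shift-< ω≤m pm)
                                   (shift-< ω≤m pm) (shift-< ω≤m pm) (cong value ε)
                in q-inj (cong₂ _,_ (shift-injective ω≤m pm (q₁≤ i) (q₁≤ j) e₁)
                                    (shift-injective ω≤m pm (q₂≤ i) (q₂≤ j) e₂))))
              where
              m<α : m < α
              m<α = ⊔-lub< a<α b<α
              pm : PairingOn (_< m)
              pm = ih m m<α ω≤m
              σ : K → K
              σ = shift ω≤m pm
              open PairingOn pm

module TreeConstruction {ℓ : Level} (em : ExcludedMiddle (suc ℓ)) (κ : Ordinal ℓ)
  (reg : OnOrdinal.IsRegularUncountableCardinal κ) (χ : Ordinal.Carrier κ)
  (p14 : OnOrdinal.P₁₄ κ (OnOrdinal.E≥ κ χ)) where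

  open RegularCardinal em κ reg public

  open PairingOn pairingK public using (pair)

  pair-injective : ∀ {a b c d} → pair a b ≡ pair c d → a ≡ c × b ≡ d
  pair-injective = PairingOn.pair-injective pairingK refl refl refl refl

  abstract
    fst snd : K → K
    fst p = least λ a → ∃[ b ] p ≡ pair a b
    snd p = least λ b → ∃[ a ] p ≡ pair a b

    fst-pair : ∀ a b → fst (pair a b) ≡ a
    fst-pair a b = least-unique _ (b , refl) λ u (_ , e) → sym (proj₁ (pair-injective e))

    snd-pair : ∀ a b → snd (pair a b) ≡ b
    snd-pair a b = least-unique _ (a , refl) λ u (_ , e) → sym (proj₂ (pair-injective e))

  F : Set ℓ
  F = K → K

  infix 4 _~[_]_
  _~[_]_ : F → K → F → Set ℓ
  f ~[ δ ] g = ∀ ξ → ξ < δ → f ξ ≡ g ξ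

  ~-refl : ∀ {δ f} → f ~[ δ ] f
  ~-refl _ _ = refl

  ~-sym : ∀ {δ f g} → f ~[ δ ] g → g ~[ δ ] f
  ~-sym p ξ q = sym (p ξ q)

  ~-trans : ∀ {δ f g h} → f ~[ δ ] g → g ~[ δ ] h → f ~[ δ ] h
  ~-trans p q ξ r = trans (p ξ r) (q ξ r)

  ~-mono : ∀ {δ ε f g} → δ ≤ ε → f ~[ ε ] g → f ~[ δ ] g
  ~-mono p q ξ r = q ξ (<-≤-trans r p)

  IsStationary⇒Closed : ∀ {A} → IsStationary A → ∀ h → ∃[ α ] (A α × Closed h α)
  IsStationary⇒Closed st h = let (α , c , a) = st (Closed h) (Closed-club h) in α , a , c

  Closed⇒> : ∀ {b α} → Closed (λ _ → b) α → b < α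
  Closed⇒> (((β , β<α) , _) , c) = c β β<α

  Z : K → Pred K ℓ
  Z = proj₁ (proj₁ p14)

  guess : ∀ A → IsStationary (λ α → A ∩ (_< α) ≐ Z α)
  guess = proj₂ (proj₂ (proj₁ p14))

  abstract
    -- By ◇ every bounded subset of κ is some Z c, so that c is a code for it.
    -- Choosing by least codes makes the construction extensional.
    decode : K → K → F
    decode c j ξ = least λ v → Z c (pair j (pair ξ v))

    encode : ∀ τ γ (s : K → F) → ∃[ c ] (∀ j → j < τ → decode c j ~[ γ ] s j)
    encode τ γ s = α , λ j j<τ ξ ξ<γ → least-unique _
        (proj₁ Zα ((j , ξ , j<τ , ξ<γ , refl) , <-trans (β-bound j ξ j<τ ξ<γ) β<α))
        λ u z → unique (proj₁ (proj₂ Zα z))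
      where
      A : Pred K ℓ
      A p = ∃[ j ] ∃[ ξ ] (j < τ × ξ < γ × p ≡ pair j (pair ξ (s j ξ)))
      unique : ∀ {j ξ u} → A (pair j (pair ξ u)) → u ≡ s j ξ
      unique (j , ξ , _ , _ , e) with pair-injective e
      ... | refl , e′ with pair-injective e′
      ... | refl , e″ = e″
      b : ∃[ β ] (∀ j ξ → j < τ → ξ < γ → pair j (pair ξ (s j ξ)) < β)
      b = bound₂ τ γ (λ j ξ → pair j (pair ξ (s j ξ)))
      β : K
      β = proj₁ b
      β-bound : ∀ j ξ → j < τ → ξ < γ → pair j (pair ξ (s j ξ)) < β
      β-bound = proj₂ b
      found : ∃[ α ] ((A ∩ (_< α) ≐ Z α) × Closed (λ _ → β) α)
      found = IsStationary⇒Closed (guess A) (λ _ → β)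
      α : K
      α = proj₁ found
      Zα : A ∩ (_< α) ≐ Z α
      Zα = proj₁ (proj₂ found)
      β<α : β < α
      β<α = Closed⇒> (proj₂ (proj₂ found))

  C : K → Pred K ℓ
  C = proj₁ (proj₂ p14)

  C-club : ∀ α → IsLimit α → IsClubIn (_< α) (C α)
  C-club = proj₁ (proj₂ (proj₂ p14))

  C-coherent : ∀ α ᾱ → ᾱ ∈ acc (C α) → C ᾱ ≐ C α ∩ (_< ᾱ)
  C-coherent = proj₁ (proj₂ (proj₂ (proj₂ p14)))

  abstract
    nxt lst : Pred K ℓ → K → K
    nxt D ξ = least λ β → D β × ξ < β
    lst D ξ = least λ γ → D γ × γ ≤ ξ × (∀ c → D c → c ≤ ξ → c ≤ γ)

    lst-≤ : ∀ D ξ → lst D ξ ≤ ξ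
    lst-≤ D ξ = least-≤ _ λ _ h → proj₁ (proj₂ h)

    nxt-unique : ∀ {D ξ β} → D β → ξ < β → (∀ c → D c → ξ < c → β ≤ c) → nxt D ξ ≡ β
    nxt-unique {D} {ξ} dβ ξ<β h = ≤-antisym
      (least-min (λ β → D β × ξ < β) (dβ , ξ<β))
      (let (d , p) = least-sat (λ β → D β × ξ < β) (dβ , ξ<β) in h _ d p)

    lst-unique : ∀ {D ξ γ} → D γ → γ ≤ ξ → (∀ c → D c → c ≤ ξ → c ≤ γ) → lst D ξ ≡ γ
    lst-unique dγ γ≤ξ h = least-unique _ (dγ , γ≤ξ , h)
      λ u (du , u≤ξ , g) → ≤-antisym (h u du u≤ξ) (g _ dγ γ≤ξ)

    nxt-∈ : ∀ {D ξ c} → D c → ξ < c → D (nxt D ξ) × ξ < nxt D ξ × nxt D ξ ≤ c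
    nxt-∈ {D} {ξ} dc ξ<c =
      let (p , q) = least-sat (λ β → D β × ξ < β) (dc , ξ<c)
      in p , q , least-min (λ β → D β × ξ < β) (dc , ξ<c)

    nxt-least : ∀ {D ξ c} → D c → ξ < c → nxt D ξ ≤ c
    nxt-least {D} {ξ} dc ξ<c = least-min (λ β → D β × ξ < β) (dc , ξ<c)

    nxt-cong : ∀ {D E ξ} θ → (∀ c → c < θ → D c → E c) → (∀ c → c < θ → E c → D c) →
      (∃[ c ] (D c × ξ < c × c < θ)) → nxt D ξ ≡ nxt E ξ
    nxt-cong {D} {E} {ξ} θ f g (c , dc , ξ<c , c<θ) =
      let (p , q , r) = nxt-∈ {D} dc ξ<c
          (p′ , q′ , r′) = nxt-∈ {E} (f c c<θ dc) ξ<c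
      in ≤-antisym (nxt-least (g _ (≤-<-trans r′ c<θ) p′) q′) (nxt-least (f _ (≤-<-trans r c<θ) p) q)

    lst-cong : ∀ {D E ξ} θ → (∀ c → c < θ → D c → E c) → (∀ c → c < θ → E c → D c) →
      ξ < θ → lst D ξ ≡ lst E ξ
    lst-cong θ f g ξ<θ = least-cong
      (λ v (d , p , h) → f v (≤-<-trans p ξ<θ) d , p , λ c ec q → h c (g c (≤-<-trans q ξ<θ) ec) q)
      (λ v (e , p , h) → g v (≤-<-trans p ξ<θ) e , p , λ c dc q → h c (f c (≤-<-trans q ξ<θ) dc) q)

  -- Z β is read as a set of pair i (pair ε d) with a single i = idx β.  This i
  -- is pair τ (pair c c′) and names the addresses (lev β j , nod β j), j < τ,
  -- and pair ε d names the sequence decode d of nodes of height ε.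
  idx wid : K → K
  idx β = fst (least (Z β))
  wid β = fst (idx β)

  lev : K → K → K
  lev β j = decode (fst (snd (idx β))) j 𝟎

  nod : K → K → F
  nod β = decode (snd (snd (idx β)))

  Levels : Set (suc ℓ)
  Levels = K → F → Set ℓ

  Address : Set ℓ
  Address = K × F

  thread : (K → Address → K) → Address → F
  thread b i ζ = b ζ i

  -- decode c continues all named branches, above an element of the guessed set.
  Sealing : Levels → K → K → (K → Address → K) → Pred K ℓ
  Sealing Q β γ b c =
    (∀ k → k < wid β → Q β (decode c k) × decode c k ~[ γ ] thread b (lev β k , nod β k)) ×
    ∃[ ε ] ∃[ d ] (ε < β × Z β (pair (idx β) (pair ε d)) ×
      (∀ k → k < wid β → decode d k ~[ ε ] decode c k))

  Match : K → Address → Pred K ℓ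
  Match β (δ , x) j = j < wid β × δ ≡ lev β j × x ~[ δ ] nod β j

  Default : Levels → K → K → (K → Address → K) → Address → Pred K ℓ
  Default Q β γ b i c = Q β (decode c 𝟎) × decode c 𝟎 ~[ γ ] thread b i

  Sealable : Levels → K → K → (K → Address → K) → Address → Set ℓ
  Sealable Q β γ b i = ∃ (Match β i) × ∃ (Sealing Q β γ b)

  Sealing-map : ∀ {Q R β γ b b′} → (∀ f → Q β f → R β f) →
    (∀ i → thread b i ~[ γ ] thread b′ i) → ∀ c → Sealing Q β γ b c → Sealing R β γ b′ c
  Sealing-map f e c (h , w) =
    (λ k p → f (decode c k) (proj₁ (h k p)) , ~-trans (proj₂ (h k p)) (e _)) , w

  Match-map : ∀ {β δ x y} → x ~[ δ ] y → ∀ j → Match β (δ , x) j → Match β (δ , y) j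
  Match-map x~y j (p , q , r) = p , q , ~-trans (~-sym x~y) r

  Default-map : ∀ {Q R β γ b b′ i i′} → (∀ f → Q β f → R β f) →
    thread b i ~[ γ ] thread b′ i′ → ∀ c → Default Q β γ b i c → Default R β γ b′ i′ c
  Default-map f e c (q , r) = f (decode c 𝟎) q , ~-trans r e

  abstract
    choice : Levels → K → K → (K → Address → K) → Address → F
    choice Q β γ b i with dec (Sealable Q β γ b i)
    ... | yes _ = decode (least (Sealing Q β γ b)) (least (Match β i))
    ... | no _ = decode (least (Default Q β γ b i)) 𝟎

    choice-sealing : ∀ {Q β γ b i} → Sealable Q β γ b i →
      choice Q β γ b i ≡ decode (least (Sealing Q β γ b)) (least (Match β i))
    choice-sealing {Q} {β} {γ} {b} {i} s with dec (Sealable Q β γ b i)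
    ... | yes _ = refl
    ... | no ¬s = ⊥-elim (¬s s)

    choice-default : ∀ {Q β γ b i} → ¬ Sealable Q β γ b i →
      choice Q β γ b i ≡ decode (least (Default Q β γ b i)) 𝟎
    choice-default {Q} {β} {γ} {b} {i} ¬s with dec (Sealable Q β γ b i)
    ... | yes s = ⊥-elim (¬s s)
    ... | no _ = refl

    choice-correct : ∀ {Q β γ b δ x} →
      (∀ j → Match β (δ , x) j → thread b (lev β j , nod β j) ~[ γ ] thread b (δ , x)) →
      ∃ (Default Q β γ b (δ , x)) →
      Q β (choice Q β γ b (δ , x)) × choice Q β γ b (δ , x) ~[ γ ] thread b (δ , x)
    choice-correct {Q} {β} {γ} {b} {δ} {x} resp (c , def) with dec (Sealable Q β γ b (δ , x))
    ... | no _ = least-sat (Default Q β γ b (δ , x)) def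
    ... | yes ((_ , m) , (_ , s)) =
      let m′ = least-sat (Match β (δ , x)) m
          (q , e) = proj₁ (least-sat (Sealing Q β γ b) s) _ (proj₁ m′)
      in q , ~-trans e (resp _ m′)

    choice-cong : ∀ {Q R β γ b b′ δ x y} → (∀ f → Q β f → R β f) → (∀ f → R β f → Q β f) →
      (∀ i → thread b i ~[ γ ] thread b′ i) →
      thread b (δ , x) ~[ γ ] thread b (δ , y) →
      x ~[ δ ] y →
      ∀ ξ → choice Q β γ b (δ , x) ξ ≡ choice R β γ b′ (δ , y) ξ
    choice-cong {Q} {R} {β} {γ} {b} {b′} {δ} {x} {y} f g e e′ x~y ξ =
      by-cases (dec (Sealable Q β γ b (δ , x))) (dec (Sealable R β γ b′ (δ , y)))
      where
      s→ : ∀ c → Sealing Q β γ b c → Sealing R β γ b′ c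
      s→ = Sealing-map {Q} {R} f e
      s← : ∀ c → Sealing R β γ b′ c → Sealing Q β γ b c
      s← = Sealing-map {R} {Q} g (λ i → ~-sym (e i))
      m→ : ∀ j → Match β (δ , x) j → Match β (δ , y) j
      m→ = Match-map x~y
      m← : ∀ j → Match β (δ , y) j → Match β (δ , x) j
      m← = Match-map (~-sym x~y)
      e₃ : thread b (δ , x) ~[ γ ] thread b′ (δ , y)
      e₃ = ~-trans e′ (e (δ , y))
      d→ : ∀ c → Default Q β γ b (δ , x) c → Default R β γ b′ (δ , y) c
      d→ = Default-map {Q} {R} {b = b} {b′} {δ , x} {δ , y} f e₃
      d← : ∀ c → Default R β γ b′ (δ , y) c → Default Q β γ b (δ , x) c
      d← = Default-map {R} {Q} {b = b′} {b} {δ , y} {δ , x} g (~-sym e₃)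
      by-cases : Dec (Sealable Q β γ b (δ , x)) → Dec (Sealable R β γ b′ (δ , y)) →
        choice Q β γ b (δ , x) ξ ≡ choice R β γ b′ (δ , y) ξ
      by-cases (yes s) (yes s′) = trans (cong (λ h → h ξ) (choice-sealing s)) (trans
        (cong₂ (λ c j → decode c j ξ) (least-cong s→ s←) (least-cong m→ m←))
        (sym (cong (λ h → h ξ) (choice-sealing s′))))
      by-cases (no ¬s) (no ¬s′) = trans (cong (λ h → h ξ) (choice-default ¬s)) (trans
        (cong (λ c → decode c 𝟎 ξ) (least-cong d→ d←))
        (sym (cong (λ h → h ξ) (choice-default ¬s′))))
      by-cases (yes ((j , m) , (c , s))) (no ¬s) = ⊥-elim (¬s ((j , m→ j m) , (c , s→ c s)))
      by-cases (no ¬s) (yes ((j , m) , (c , s))) = ⊥-elim (¬s ((j , m← j m) , (c , s← c s)))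

  branchStep : Levels → Pred K ℓ → K → (K → Address → K) → Address → K
  branchStep Q D ξ b (δ , x) with dec (ξ < δ)
  ... | yes _ = x ξ
  ... | no _ = choice Q (nxt D ξ) (lst D ξ) b (δ , x) ξ

  branchStep-cong : ∀ {Q R D E ξ b b′ δ x y} → nxt D ξ ≡ nxt E ξ → lst D ξ ≡ lst E ξ →
    (∀ f → Q (nxt D ξ) f → R (nxt D ξ) f) → (∀ f → R (nxt D ξ) f → Q (nxt D ξ) f) →
    (∀ ζ → ζ < ξ → ∀ i → b ζ i ≡ b′ ζ i) →
    thread b (δ , x) ~[ ξ ] thread b (δ , y) →
    x ~[ δ ] y →
    branchStep Q D ξ b (δ , x) ≡ branchStep R E ξ b′ (δ , y)
  branchStep-cong {Q} {R} {D} {E} {ξ} {δ = δ} en el f g e e′ x~y with dec (ξ < δ)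
  ... | yes p = x~y ξ p
  ... | no _ rewrite sym en | sym el =
    choice-cong f g (λ i ζ p → e ζ (<-≤-trans p (lst-≤ D ξ)) i) (~-mono (lst-≤ D ξ) e′) x~y ξ

  branchStep-ext : ∀ Q D ξ g h → (∀ ζ → ζ < ξ → ∀ i → g ζ i ≡ h ζ i) →
    ∀ i → branchStep Q D ξ g i ≡ branchStep Q D ξ h i
  branchStep-ext Q D ξ g h e i =
    branchStep-cong {Q} {Q} {D} {D} refl refl (λ _ q → q) (λ _ q → q) e ~-refl ~-refl

  module BranchRec (Q : Levels) (D : Pred K ℓ) =
    Recursion {I = Address} (Ordinal.wellFounded κ) 𝟎 (branchStep Q D) (branchStep-ext Q D)

  branch : Levels → Pred K ℓ → K → Address → K
  branch = BranchRec.rec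

  branch-eq : ∀ Q D ξ i → branch Q D ξ i ≡ branchStep Q D ξ (branch Q D) i
  branch-eq = BranchRec.rec-eq

  branch-cong : ∀ {Q R D E} θ →
    (∀ ξ → ξ < θ → nxt D ξ ≡ nxt E ξ × lst D ξ ≡ lst E ξ ×
      (∀ f → Q (nxt D ξ) f → R (nxt D ξ) f) × (∀ f → R (nxt D ξ) f → Q (nxt D ξ) f)) →
    ∀ ξ → ξ < θ → ∀ i → branch Q D ξ i ≡ branch R E ξ i
  branch-cong {Q} {R} {D} {E} θ h = wfInd _ λ ξ ih ξ<θ i →
    let (en , el , f , g) = h ξ ξ<θ
    in trans (branch-eq Q D ξ i) (trans
         (branchStep-cong en el f g (λ ζ ζ<ξ → ih ζ ζ<ξ (<-trans ζ<ξ ξ<θ)) ~-refl ~-refl)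
         (sym (branch-eq R E ξ i)))

  branch-resp : ∀ Q D {δ x y} → x ~[ δ ] y → ∀ ξ → branch Q D ξ (δ , x) ≡ branch Q D ξ (δ , y)
  branch-resp Q D {δ} {x} {y} x~y = wfInd _ λ ξ ih →
    trans (branch-eq Q D ξ _) (trans
      (branchStep-cong refl refl (λ _ q → q) (λ _ q → q) (λ _ _ _ → refl) ih x~y)
      (sym (branch-eq Q D ξ _)))

  branch-below : ∀ Q D {δ x} → thread (branch Q D) (δ , x) ~[ δ ] x
  branch-below Q D {δ} {x} ξ ξ<δ = trans (branch-eq Q D ξ (δ , x)) lem
    where
    lem : branchStep Q D ξ (branch Q D) (δ , x) ≡ x ξ
    lem with dec (ξ < δ)
    ... | yes _ = refl
    ... | no ¬p = ⊥-elim (¬p ξ<δ)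

  branch-above : ∀ Q D {δ x ξ} → δ ≤ ξ →
    branch Q D ξ (δ , x) ≡ choice Q (nxt D ξ) (lst D ξ) (branch Q D) (δ , x) ξ
  branch-above Q D {δ} {x} {ξ} δ≤ξ = trans (branch-eq Q D ξ (δ , x)) lem
    where
    lem : branchStep Q D ξ (branch Q D) (δ , x) ≡ choice Q (nxt D ξ) (lst D ξ) (branch Q D) (δ , x) ξ
    lem with dec (ξ < δ)
    ... | yes p = ⊥-elim (<⇒≱ p δ≤ξ)
    ... | no _ = refl

  -- The levels of the tree

  StepLevel : K → Levels → F → Set ℓ
  StepLevel α Q f =
    (α ≡ 𝟎) ⊎
    (∃[ β ] (α ≡ S β × Q β f × (f β <ω ⊎ f β < β))) ⊎
    (IsLimit α × ∃[ δ ] ∃[ x ] (C α δ × Q δ x × f ~[ α ] thread (branch Q (C α)) (δ , x)))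

  C-⊆ : ∀ {α c} → IsLimit α → C α c → c < α
  C-⊆ lim = proj₁ (proj₁ (C-club _ lim))

  C-cofinal : ∀ {α β} → IsLimit α → β < α → ∃[ c ] (C α c × β < c × c < α)
  C-cofinal {α} {β} lim β<α =
    let (γ , β<γ , γ<α) = proj₂ lim β β<α
        (c , Cc , γ≤c) = proj₂ (proj₁ (C-club α lim)) γ γ<α
    in c , Cc , <-≤-trans β<γ γ≤c , C-⊆ lim Cc

  nxt-C : ∀ {α ξ} → IsLimit α → ξ < α →
    C α (nxt (C α) ξ) × ξ < nxt (C α) ξ × nxt (C α) ξ < α
  nxt-C lim ξ<α = let (c , Cc , ξ<c , c<α) = C-cofinal lim ξ<α
                      (p , q , r) = nxt-∈ Cc ξ<c
                  in p , q , ≤-<-trans r c<α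

  StepLevel-mono : ∀ {α Q R} → (∀ β → β < α → ∀ f → Q β f → R β f) →
    (∀ β → β < α → ∀ f → R β f → Q β f) → ∀ f → StepLevel α Q f → StepLevel α R f
  StepLevel-mono f g h (inj₁ e) = inj₁ e
  StepLevel-mono f g h (inj₂ (inj₁ (β , refl , q , r))) = inj₂ (inj₁ (β , refl , f β <S h q , r))
  StepLevel-mono {α} {Q} {R} f g h (inj₂ (inj₂ (lim , δ , x , Cδ , q , e))) =
    inj₂ (inj₂ (lim , δ , x , Cδ , f δ (C-⊆ lim Cδ) x q , ~-trans e λ ξ ξ<α →
      branch-cong {Q} {R} {C α} {C α} α
        (λ ζ ζ<α → let n<α = proj₂ (proj₂ (nxt-C lim ζ<α)) in refl , refl , f _ n<α , g _ n<α) ξ ξ<α (δ , x)))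

  does-cong : {P Q : Set ℓ} → (P → Q) → (Q → P) → does (dec P) ≡ does (dec Q)
  does-cong {P} {Q} f g with dec P | dec Q
  ... | yes _ | yes _ = refl
  ... | no _ | no _ = refl
  ... | yes p | no ¬q = ⊥-elim (¬q (f p))
  ... | no ¬p | yes q = ⊥-elim (¬p (g q))

  levelStep : K → (K → F → Lift ℓ Bool) → F → Lift ℓ Bool
  levelStep α g f = lift (does (dec (StepLevel α (λ β f → g β f ≡ lift true) f)))

  levelStep-ext : ∀ α g h → (∀ β → β < α → ∀ f → g β f ≡ h β f) →
    ∀ f → levelStep α g f ≡ levelStep α h f
  levelStep-ext α g h e f = cong lift (does-cong
    (StepLevel-mono (λ β p f → trans (sym (e β p f))) (λ β p f → trans (e β p f)) f)
    (StepLevel-mono (λ β p f → trans (e β p f)) (λ β p f → trans (sym (e β p f))) f))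

  module LevelRec = Recursion {I = F} {V = Lift ℓ Bool} (Ordinal.wellFounded κ) (lift false) levelStep levelStep-ext

  abstract
    L : Levels
    L α f = LevelRec.rec α f ≡ lift true

    L⇒ : ∀ {α f} → L α f → StepLevel α L f
    L⇒ {α} {f} l = out (trans (sym (LevelRec.rec-eq α f)) l)
      where
      out : ∀ {P : Set ℓ} → lift {ℓ = ℓ} (does (dec P)) ≡ lift true → P
      out {P} e with dec P
      out e | yes p = p
      out () | no _

    L⇐ : ∀ {α f} → StepLevel α L f → L α f
    L⇐ {α} {f} s = trans (LevelRec.rec-eq α f) (into s)
      where
      into : ∀ {P : Set ℓ} → P → lift {ℓ = ℓ} (does (dec P)) ≡ lift true
      into {P} p with dec P
      ... | yes _ = refl
      ... | no ¬p = ⊥-elim (¬p p)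

  L-resp : ∀ {α f g} → f ~[ α ] g → L α f → L α g
  L-resp {α} {f} {g} = wfInd (λ α → ∀ {f g} → f ~[ α ] g → L α f → L α g) step α
    where
    step : ∀ α → (∀ β → β < α → ∀ {f g} → f ~[ β ] g → L β f → L β g) →
      ∀ {f g} → f ~[ α ] g → L α f → L α g
    step α ih {f} {g} e l with L⇒ l
    ... | inj₁ p = L⇐ (inj₁ p)
    ... | inj₂ (inj₁ (β , refl , q , r)) = L⇐ (inj₂ (inj₁ (β , refl ,
            ih β <S (~-mono (<⇒≤ <S) e) q , subst (λ v → v <ω ⊎ v < β) (e β <S) r)))
    ... | inj₂ (inj₂ (lim , δ , x , Cδ , q , e′)) = L⇐ (inj₂ (inj₂ (lim , δ , x , Cδ , q ,
            ~-trans (~-sym e) e′)))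

  upd : F → K → K → F
  upd f β v ξ with dec (ξ ≡ β)
  ... | yes _ = v
  ... | no _ = f ξ

  upd-≡ : ∀ f β v → upd f β v β ≡ v
  upd-≡ f β v with dec (β ≡ β)
  ... | yes _ = refl
  ... | no ¬p = ⊥-elim (¬p refl)

  upd-~ : ∀ f β v → upd f β v ~[ β ] f
  upd-~ f β v ξ ξ<β with dec (ξ ≡ β)
  ... | yes refl = ⊥-elim (<-irrefl ξ<β)
  ... | no _ = refl

  L-S⇐ : ∀ {β f v} → L β f → v <ω ⊎ v < β → L (S β) (upd f β v)
  L-S⇐ {β} {f} {v} l p = L⇐ (inj₂ (inj₁ (β , refl , L-resp (~-sym (upd-~ f β v)) l ,
    subst (λ u → u <ω ⊎ u < β) (sym (upd-≡ f β v)) p)))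

  𝟎<ω : 𝟎 <ω
  𝟎<ω = num<ω 0

  br : K → Address → F
  br α = thread (branch L (C α))

  L-limit⇒ : ∀ {α f} → IsLimit α → L α f →
    ∃[ δ ] ∃[ x ] (C α δ × L δ x × f ~[ α ] br α (δ , x))
  L-limit⇒ lim l with L⇒ l
  ... | inj₁ e = ⊥-elim (IsLimit⇒≢𝟎 lim e)
  ... | inj₂ (inj₁ (β , e , _)) = ⊥-elim (IsLimit⇒≢S lim e)
  ... | inj₂ (inj₂ (_ , r)) = r

  L-S⇒ : ∀ {β f} → L (S β) f → L β f × (f β <ω ⊎ f β < β)
  L-S⇒ {β} {f} l with L⇒ l
  ... | inj₁ e = ⊥-elim (𝟎≢S (sym e))
  ... | inj₂ (inj₂ (lim , _)) = ⊥-elim (IsLimit⇒≢S lim refl)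
  ... | inj₂ (inj₁ (β′ , e , q , r)) with S-injective e
  ... | refl = q , r

  L-limit⇐ : ∀ {α δ x} → IsLimit α → C α δ → L δ x → L α (br α (δ , x))
  L-limit⇐ lim Cδ l = L⇐ (inj₂ (inj₂ (lim , _ , _ , Cδ , l , ~-refl)))

  IsAccPoint⇒IsLimit : ∀ {X γ} → IsAccPoint X γ → IsLimit γ
  IsAccPoint⇒IsLimit a@(pos , _) = pos , λ β β<γ →
    let (ε , _ , p , q) = IsAccPoint-below a β<γ in ε , p , q

  IsPred : K → K → K → Set ℓ
  IsPred α γ⁻ γ = C α γ⁻ × γ⁻ < γ × (∀ c → C α c → c < γ → c ≤ γ⁻)

  pred-or-acc : ∀ {α γ d} → IsLimit α → C α γ → C α d → d < γ →
    ∃[ γ⁻ ] IsPred α γ⁻ γ ⊎ IsAccPoint (C α) γ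
  pred-or-acc {α} {γ} {d} lim Cγ Cd d<γ with dec (∃[ γ⁻ ] IsPred α γ⁻ γ)
  ... | yes p = inj₁ p
  ... | no ¬max = inj₂ ((d , d<γ) , (λ { (_ , p) → inj₁ p }) , λ τ ub → ≮⇒≥ (λ τ<γ → no-ub ub τ<γ))
    where
    bigger : ∀ {c} → C α c → c < γ → ∃[ c′ ] (C α c′ × c′ < γ × c < c′)
    bigger {c} Cc c<γ = dne λ ¬b → ¬max (c , Cc , c<γ , λ c′ Cc′ c′<γ →
      ≮⇒≥ λ c<c′ → ¬b (c′ , Cc′ , c′<γ , c<c′))
    UB : Pred K ℓ
    UB τ = ∀ β → C α β → β < γ → β ≤ τ
    no-ub : ∀ {τ} → (∀ {β} → β ∈ (C α ∩ (_< γ)) → β ≤ τ) → ¬ τ < γ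
    no-ub {τ} ub τ<γ = ¬max (σ , Cσ , σ<γ , σ-ub)
      where
      ubτ : UB τ
      ubτ β Cβ β<γ = ub (Cβ , β<γ)
      σ : K
      σ = least UB
      σ-ub : UB σ
      σ-ub = least-sat UB ubτ
      σ<γ : σ < γ
      σ<γ = ≤-<-trans (least-min UB ubτ) τ<γ
      below-σ : ∀ {c} → C α c → c < γ → c < σ
      below-σ Cc c<γ = let (c′ , Cc′ , c′<γ , c<c′) = bigger Cc c<γ
                       in <-≤-trans c<c′ (σ-ub c′ Cc′ c′<γ)
      Cσ : C α σ
      Cσ = proj₂ (C-club α lim) σ (<-trans σ<γ (C-⊆ lim Cγ))
        ((d , below-σ Cd d<γ) , (λ { (_ , p) → inj₁ p }) ,
         λ τ′ ub′ → least-min UB λ β Cβ β<γ → ub′ (Cβ , below-σ Cβ β<γ))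

  br-choice : ∀ {α γ⁻ γ δ x} → C α γ → IsPred α γ⁻ γ → δ ≤ γ⁻ →
    ∀ ξ → γ⁻ ≤ ξ → ξ < γ → br α (δ , x) ξ ≡ choice L γ γ⁻ (branch L (C α)) (δ , x) ξ
  br-choice {α} {γ⁻} {γ} {δ} {x} Cγ (Cγ⁻ , _ , max) δ≤γ⁻ ξ γ⁻≤ξ ξ<γ =
    subst₂ (λ β ε → br α (δ , x) ξ ≡ choice L β ε (branch L (C α)) (δ , x) ξ)
      (nxt-unique Cγ ξ<γ λ c Cc ξ<c → ≮⇒≥ λ c<γ → <⇒≱ ξ<c (≤-trans (max c Cc c<γ) γ⁻≤ξ))
      (lst-unique Cγ⁻ γ⁻≤ξ λ c Cc c≤ξ → max c Cc (≤-<-trans c≤ξ ξ<γ))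
      (branch-above L (C α) (≤-trans δ≤γ⁻ γ⁻≤ξ))

  br-coherent : ∀ {α γ} → C α γ → IsAccPoint (C α) γ → ∀ i → br α i ~[ γ ] br γ i
  br-coherent {α} {γ} Cγ accγ i ξ ξ<γ = branch-cong {L} {L} {C α} {C γ} γ
    (λ ζ ζ<γ → nxt-cong γ to from
        (let (c , Cc , p , q) = IsAccPoint-below accγ ζ<γ in c , Cc , p , q) ,
      lst-cong γ to from ζ<γ , (λ _ l → l) , (λ _ l → l)) ξ ξ<γ i
    where
    to : ∀ c → c < γ → C α c → C γ c
    to c c<γ Cc = proj₂ (C-coherent α γ (Cγ , accγ)) (Cc , c<γ)
    from : ∀ c → c < γ → C γ c → C α c
    from c _ Cc = proj₁ (proj₁ (C-coherent α γ (Cγ , accγ)) Cc)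

  record Normal (α : K) : Set ℓ where
    field
      down : ∀ {f β} → β < α → L α f → L β f
      extend : ∀ {f β} → β < α → L β f → ∃[ g ] (L α g × g ~[ β ] f)

  module _ {α} (lim : IsLimit α) (ih : ∀ β → β < α → Normal β) where

    br-level : ∀ {δ x} → C α δ → L δ x → ∀ γ → C α γ → δ ≤ γ → L γ (br α (δ , x))
    br-level {δ} {x} Cδ l = wfInd _ step
      where
      step : ∀ γ → (∀ β → β < γ → C α β → δ ≤ β → L β (br α (δ , x))) →
        C α γ → δ ≤ γ → L γ (br α (δ , x))
      step γ ihγ Cγ (inj₂ refl) = L-resp (~-sym (branch-below L (C α))) l
      step γ ihγ Cγ (inj₁ δ<γ) with pred-or-acc lim Cγ Cδ δ<γ
      ... | inj₁ (γ⁻ , isp@(Cγ⁻ , γ⁻<γ , max)) = L-resp (~-sym br~) (proj₁ ch)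
        where
        δ≤γ⁻ : δ ≤ γ⁻
        δ≤γ⁻ = max δ Cδ δ<γ
        def : ∃ (Default L γ γ⁻ (branch L (C α)) (δ , x))
        def = let (g , lg , g~) = Normal.extend (ih γ (C-⊆ lim Cγ)) γ⁻<γ (ihγ γ⁻ γ⁻<γ Cγ⁻ δ≤γ⁻)
                  (c , e) = encode (S 𝟎) γ (λ _ → g)
                  e₀ = e 𝟎 <S
              in c , L-resp (~-sym e₀) lg , ~-trans (~-mono (<⇒≤ γ⁻<γ) e₀) g~
        ch = choice-correct {L} {γ} {γ⁻} {branch L (C α)} {δ} {x}
          (λ { j (_ , refl , x~) ξ _ → branch-resp L (C α) (~-sym x~) ξ }) def
        br~ : br α (δ , x) ~[ γ ] choice L γ γ⁻ (branch L (C α)) (δ , x)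
        br~ ξ ξ<γ with <-or-≥ ξ γ⁻
        ... | inj₁ ξ<γ⁻ = sym (proj₂ ch ξ ξ<γ⁻)
        ... | inj₂ γ⁻≤ξ = br-choice Cγ isp δ≤γ⁻ ξ γ⁻≤ξ ξ<γ
      ... | inj₂ accγ = L-resp (~-sym (br-coherent Cγ accγ (δ , x)))
              (L-limit⇐ (IsAccPoint⇒IsLimit accγ)
                (proj₂ (C-coherent α γ (Cγ , accγ)) (Cδ , δ<γ)) l)

    br-down : ∀ {δ x β} → C α δ → L δ x → β < α → L β (br α (δ , x))
    br-down {δ} {x} {β} Cδ l β<α =
      let (c , Cc , p , c<α) = C-cofinal lim (⊔-lub< (C-⊆ lim Cδ) β<α)
      in Normal.down (ih c c<α) (≤-<-trans (b≤a⊔b δ β) p)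
           (br-level Cδ l c Cc (<⇒≤ (≤-<-trans (a≤a⊔b δ β) p)))

  abstract
    normal : ∀ α → Normal α
    normal = wfInd Normal step
      where
      step : ∀ α → (∀ β → β < α → Normal β) → Normal α
      step α ih with cases α
      ... | inj₁ refl = record { down = λ p → ⊥-elim (≮𝟎 p) ; extend = λ p → ⊥-elim (≮𝟎 p) }
      ... | inj₂ (inj₁ (β , refl)) = record { down = down ; extend = extend }
        where
        down : ∀ {f γ} → γ < S β → L (S β) f → L γ f
        down p l with <S⇒≤ p
        ... | inj₁ q = Normal.down (ih β <S) q (proj₁ (L-S⇒ l))
        ... | inj₂ refl = proj₁ (L-S⇒ l)
        extend : ∀ {f γ} → γ < S β → L γ f → ∃[ g ] (L (S β) g × g ~[ γ ] f)
        extend {f} p l with <S⇒≤ p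
        ... | inj₂ refl = upd f β 𝟎 , L-S⇐ l (inj₁ 𝟎<ω) , upd-~ f β 𝟎
        ... | inj₁ q = let (g , lg , e) = Normal.extend (ih β <S) q l
                       in upd g β 𝟎 , L-S⇐ lg (inj₁ 𝟎<ω) , ~-trans (~-mono (<⇒≤ q) (upd-~ g β 𝟎)) e
      ... | inj₂ (inj₂ lim) = record
        { down = λ {f} {β} p l → let (δ , x , Cδ , lx , e) = L-limit⇒ lim l
            in L-resp (~-sym (~-mono (<⇒≤ p) e)) (br-down lim ih Cδ lx p)
        ; extend = λ {f} {β} p l →
            let (c , Cc , β<c , c<α) = C-cofinal lim p
                (g , lg , e) = Normal.extend (ih c c<α) β<c l
            in br α (c , g) , L-limit⇐ lim Cc lg ,
               ~-trans (~-mono (<⇒≤ β<c) (branch-below L (C α))) e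
        }

  L-down : ∀ {α β f} → β ≤ α → L α f → L β f
  L-down (inj₁ p) l = Normal.down (normal _) p l
  L-down (inj₂ refl) l = l

  L-extend : ∀ {α β f} → β ≤ α → L β f → ∃[ g ] (L α g × g ~[ β ] f)
  L-extend (inj₁ p) l = Normal.extend (normal _) p l
  L-extend {f = f} (inj₂ refl) l = f , l , ~-refl

  L-𝟎 : ∀ {f} → L 𝟎 f
  L-𝟎 = L⇐ (inj₁ refl)

  mu : K → K
  mu α = α ⊔ ω

  mu-mono : ∀ {α β} → α ≤ β → mu α ≤ mu β
  mu-mono p = ⊔-lub (≤-trans p (a≤a⊔b _ _)) (b≤a⊔b _ _)

  mu-pairing : ∀ α → PairingOn (_< mu α)
  mu-pairing α = hessenberg (mu α) (b≤a⊔b α ω)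

  record Labelling (α : K) : Set ℓ where
    field
      lab     : F → K
      lab-<   : ∀ {f} → L α f → lab f < mu α
      lab-inj : ∀ {f g} → L α f → L α g → lab f ≡ lab g → f ~[ α ] g

  abstract
    labelling : ∀ α → Labelling α
    labelling = wfInd Labelling step
      where
      step : ∀ α → (∀ β → β < α → Labelling β) → Labelling α
      step α ih with cases α
      ... | inj₁ refl = record
        { lab = λ _ → 𝟎 ; lab-< = λ _ → <-≤-trans (num<ω̂ 0) (b≤a⊔b 𝟎 ω)
        ; lab-inj = λ _ _ _ ξ ξ<𝟎 → ⊥-elim (≮𝟎 ξ<𝟎) }
      ... | inj₂ (inj₁ (β , refl)) = record { lab = lab′ ; lab-< = lab′-< ; lab-inj = lab′-inj }
        where
        open Labelling (ih β <S)
        open PairingOn (mu-pairing (S β)) renaming (pair to pr)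
        lab′ : F → K
        lab′ f = pr (lab f) (f β)
        left< : ∀ {f} → L (S β) f → lab f < mu (S β)
        left< l = <-≤-trans (lab-< (proj₁ (L-S⇒ l))) (mu-mono (<⇒≤ <S))
        right< : ∀ {f} → L (S β) f → f β < mu (S β)
        right< l with proj₂ (L-S⇒ l)
        ... | inj₁ p = <-≤-trans (<ω⇒<ω̂ p) (b≤a⊔b _ _)
        ... | inj₂ p = <-≤-trans (<-trans p <S) (a≤a⊔b _ _)
        lab′-< : ∀ {f} → L (S β) f → lab′ f < mu (S β)
        lab′-< l = pair-closed (left< l) (right< l)
        lab′-inj : ∀ {f g} → L (S β) f → L (S β) g → lab′ f ≡ lab′ g → f ~[ S β ] g
        lab′-inj l l′ e ξ ξ<Sβ
          with PairingOn.pair-injective (mu-pairing (S β)) (left< l) (right< l) (left< l′) (right< l′) e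
             | <S⇒≤ ξ<Sβ
        ... | (e₁ , e₂) | inj₁ ξ<β = lab-inj (proj₁ (L-S⇒ l)) (proj₁ (L-S⇒ l′)) e₁ ξ ξ<β
        ... | (e₁ , e₂) | inj₂ refl = e₂
      ... | inj₂ (inj₂ lim) = record { lab = lab′ ; lab-< = lab′-< ; lab-inj = lab′-inj }
        where
        open PairingOn (mu-pairing α) renaming (pair to pr)
        labOf : K → F → K
        labOf δ with dec (δ < α)
        ... | yes p = Labelling.lab (ih δ p)
        ... | no _ = λ _ → 𝟎
        labOf-< : ∀ {δ x} → δ < α → L δ x → labOf δ x < mu α
        labOf-< {δ} p l with dec (δ < α)
        ... | yes q = <-≤-trans (Labelling.lab-< (ih δ q) l) (mu-mono (<⇒≤ q))
        ... | no ¬q = ⊥-elim (¬q p)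
        labOf-inj : ∀ {δ x y} → δ < α → L δ x → L δ y → labOf δ x ≡ labOf δ y → x ~[ δ ] y
        labOf-inj {δ} p l l′ e with dec (δ < α)
        ... | yes q = Labelling.lab-inj (ih δ q) l l′ e
        ... | no ¬q = ⊥-elim (¬q p)
        Origin : F → Set ℓ
        Origin f = ∃[ δ ] ∃[ x ] (C α δ × L δ x × f ~[ α ] br α (δ , x))
        labOrigin : ∀ {f} → Origin f → K
        labOrigin (δ , x , _) = pr δ (labOf δ x)
        lab′ : F → K
        lab′ f with dec (Origin f)
        ... | yes o = labOrigin o
        ... | no _ = 𝟎
        δ<mu : ∀ {δ} → C α δ → δ < mu α
        δ<mu Cδ = <-≤-trans (C-⊆ lim Cδ) (a≤a⊔b _ _)
        lab′-< : ∀ {f} → L α f → lab′ f < mu α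
        lab′-< {f} l with dec (Origin f)
        ... | yes (δ , x , Cδ , lx , _) = pair-closed (δ<mu Cδ) (labOf-< (C-⊆ lim Cδ) lx)
        ... | no ¬o = ⊥-elim (¬o (L-limit⇒ lim l))
        lab′-inj : ∀ {f g} → L α f → L α g → lab′ f ≡ lab′ g → f ~[ α ] g
        lab′-inj {f} {g} l l′ e with dec (Origin f) | dec (Origin g)
        ... | no ¬o | _ = ⊥-elim (¬o (L-limit⇒ lim l))
        ... | yes _ | no ¬o = ⊥-elim (¬o (L-limit⇒ lim l′))
        ... | yes (δ , x , Cδ , lx , ef) | yes (ε , y , Cε , ly , eg)
          with PairingOn.pair-injective (mu-pairing α) (δ<mu Cδ) (labOf-< (C-⊆ lim Cδ) lx) (δ<mu Cε) (labOf-< (C-⊆ lim Cε) ly) e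
        ... | refl , e₂ = ~-trans ef (~-trans
          (λ ξ _ → branch-resp L (C α) (labOf-inj (C-⊆ lim Cδ) lx ly e₂) ξ) (~-sym eg))

  module _ (α : K) where
    open Labelling (labelling α) public

  record SmallPowers (τ : K) : Set ℓ where
    field
      size      : K → K
      index     : K → (K → K) → K
      index-<   : ∀ {m t} → (∀ j → j < τ → t j < m) → index m t < size m
      index-inj : ∀ {m t u} → (∀ j → j < τ → t j < m) → (∀ j → j < τ → u j < m) →
                  index m t ≡ index m u → t ~[ τ ] u

  record Width (τ : K) : Set ℓ where
    field
      positive    : 𝟎 < τ
      smallPowers : SmallPowers τ
      bounded     : ∀ {α} → E≥ χ α → IsLimit α → (d : K → K) → (∀ j → j < τ → d j < α) →
                    ∃[ θ ] (θ < α × (∀ j → j < τ → d j < θ))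

  width-1 : Width (S 𝟎)
  width-1 = record
    { positive    = <S
    ; smallPowers = record
      { size = λ m → m ; index = λ _ t → t 𝟎 ; index-< = λ h → h 𝟎 <S
      ; index-inj = λ {_} {t} {u} _ _ e j j<1 → at t u j<1 e }
    ; bounded     = λ _ lim d h → S (d 𝟎) , IsLimit-S lim (h 𝟎 <S) ,
        λ j j<1 → subst (λ j → d j < S (d 𝟎)) (sym (is𝟎 j<1)) <S
    }
    where
    is𝟎 : ∀ {j} → j < S 𝟎 → j ≡ 𝟎
    is𝟎 p = ≤-antisym (<S⇒≤ p) (𝟎≤ _)
    at : ∀ (t u : K → K) {j} → j < S 𝟎 → t 𝟎 ≡ u 𝟎 → t j ≡ u j
    at t u p e rewrite is𝟎 p = e

  width-<χ : (∀ μ → IsCardinal μ → Power<κ μ χ) → ∀ {τ} → Positive τ → τ < χ → Width τ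
  width-<χ pow {τ} (β , β<τ) τ<χ = record
    { positive    = ≤-<-trans (𝟎≤ β) β<τ
    ; smallPowers = record
      { size = size ; index = index
      ; index-< = λ {m} {t} → index-< m t ; index-inj = λ {m} {t} {u} → index-inj m t u }
    ; bounded     = λ {α} (γ , (_ , small) , χ≤γ) (_ , lim) d h → dne λ ¬b →
        small τ (<-≤-trans τ<χ χ≤γ)
          ((λ i → d (value i)) , (λ i → h _ (segOut i)) , λ β β<α → dne λ ¬i →
            let (β′ , β<β′ , β′<α) = lim β β<α in
            ¬b (β′ , β′<α , λ j j<τ → <-trans (≰⇒> λ β≤ → ¬i (below j j<τ , β≤)) β<β′))
    }
    where
    module _ (m : K) where
      c : K
      c = least (Embeds m)
      m↪c : Embeds m c
      m↪c = least-sat (Embeds m) {m} ((λ a → a) , (λ _ p → p) , λ _ _ _ _ e → e)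
      c-cardinal : IsCardinal c
      c-cardinal a a<c inj = <⇒≱ a<c (least-min (Embeds m) (↣⇒Embeds (inj ↣-∘ Embeds⇒↣ m↪c)))
      size : K
      size = proj₁ (pow c c-cardinal)
      φ : F
      φ = proj₁ m↪c
      Small : F → Set ℓ
      Small t = ∀ j → j < τ → t j < m
      toNode : ∀ t → Small t → Σ[ x ∈ Node ] (dom x < χ × (∀ i → fun x i < c))
      toNode t h = node τ (λ i → φ (t (value i))) , τ<χ ,
        λ i → proj₁ (proj₂ m↪c) _ (h _ (segOut i))
      index : F → K
      index t with dec (Small t)
      ... | yes h = value (Injection.to (proj₂ (pow c c-cardinal)) (toNode t h))
      ... | no _ = 𝟎
      index-< : ∀ t → Small t → index t < size
      index-< t h with dec (Small t)
      ... | yes h′ = segOut (Injection.to (proj₂ (pow c c-cardinal)) (toNode t h′))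
      ... | no ¬h = ⊥-elim (¬h h)
      index-inj : ∀ t u → Small t → Small u → index t ≡ index u → t ~[ τ ] u
      index-inj t u h k e j j<τ with dec (Small t) | dec (Small u)
      ... | no ¬h | _ = ⊥-elim (¬h h)
      ... | _ | no ¬k = ⊥-elim (¬k k)
      ... | yes h′ | yes k′ =
        let same = Injection.injective (proj₂ (pow c c-cardinal)) {toNode t h′} {toNode u k′}
                     (seg≡ {i = Injection.to (proj₂ (pow c c-cardinal)) (toNode t h′)}
                           {Injection.to (proj₂ (pow c c-cardinal)) (toNode u k′)} e)
            (_ , e′) = proj₁ same {j , φ (t j)} (j<τ , refl)
        in sym (proj₂ (proj₂ m↪c) _ _ (k′ j j<τ) (h′ j j<τ) e′)

  br-≡ : ∀ {α δ δ′ x x′} → δ ≡ δ′ → x ~[ δ ] x′ → ∀ ξ → br α (δ , x) ξ ≡ br α (δ′ , x′) ξ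
  br-≡ {α} refl x~ ξ = branch-resp L (C α) x~ ξ

  representatives : {X : Set ℓ} (A : X → Set ℓ) (J : X → K) (ν : K) → (∀ x → A x → J x < ν) →
    (val : ∀ x → A x → K) →
    ∃[ β ] (∀ x → A x → Σ[ x′ ∈ X ] Σ[ a ∈ A x′ ] (J x′ ≡ J x × val x′ a < β))
  representatives {X} A J ν J<ν val = proj₁ b , λ x a → rep x a
    where
    Hit : K → Set ℓ
    Hit v = Σ[ x ∈ X ] Σ[ a ∈ A x ] J x ≡ v
    g : K → K
    g v with dec (Hit v)
    ... | yes (x , a , _) = val x a
    ... | no _ = 𝟎
    b : ∃[ β ] (∀ v → v < ν → g v < β)
    b = bound ν g
    rep : ∀ x → A x → Σ[ x′ ∈ X ] Σ[ a ∈ A x′ ] (J x′ ≡ J x × val x′ a < proj₁ b)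
    rep x a with dec (Hit (J x)) | proj₂ b (J x) (J<ν x a)
    ... | yes (x′ , a′ , e) | p = x′ , a′ , e , p
    ... | no ¬h | _ = ⊥-elim (¬h (x , a , refl))

  IsSup-above : ∀ {X σ θ} → IsSup X σ → θ < σ → ∃[ γ ] (X γ × θ < γ)
  IsSup-above {X} {σ} {θ} (_ , lub) θ<σ = dne λ ¬γ →
    <⇒≱ θ<σ (lub θ λ {β} xβ → ≮⇒≥ λ θ<β → ¬γ (β , xβ , θ<β))

  nxt∈succω : ∀ {α γ} → IsLimit α → C α γ → succω (C α ∩ (γ ≤_)) (nxt (C α) γ)
  nxt∈succω {α} {γ} lim Cγ = (Cβ , <⇒≤ γ<β) , S 𝟎 , (f , iso) , (𝟎 , <S) , num<ω 1
    where
    β : K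
    β = nxt (C α) γ
    n : C α β × γ < β × β < α
    n = nxt-C lim (C-⊆ lim Cγ)
    Cβ : C α β
    Cβ = proj₁ n
    γ<β : γ < β
    γ<β = proj₁ (proj₂ n)
    X : Pred K ℓ
    X = (C α ∩ (γ ≤_)) ∩ (_< β)
    onlyγ : ∀ {x} → X x → x ≡ γ
    onlyγ ((Cx , γ≤x) , x<β) = ≤-antisym (≮⇒≥ λ γ<x → <⇒≱ x<β (nxt-least Cx γ<x)) γ≤x
    f : ∃ X → Seg (S 𝟎)
    f _ = below 𝟎 <S
    iso : IsOrderIsomorphism _ _ _ _ f
    iso = record
      { isOrderMonomorphism = record
        { isOrderHomomorphism = record
          { cong = λ _ → refl
          ; mono = λ { {x , p} {y , q} x<y → ⊥-elim (<-irrefl (subst₂ _<_ (onlyγ p) (onlyγ q) x<y)) } }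
        ; injective = λ { {x , p} {y , q} _ → trans (onlyγ p) (sym (onlyγ q)) }
        ; cancel = λ p → ⊥-elim (<-irrefl p) }
      ; surjective = λ y → (γ , (Cγ , ≤-refl) , γ<β) , λ _ → sym (≤-antisym (<S⇒≤ (segOut y)) (𝟎≤ _)) }

  module Derived {τ} (W : Width τ) (w : K → F) (β₀ : K)
    (wL : ∀ j → j < τ → L β₀ (w j))
    (w-inj : ∀ j k → j < τ → k < τ → w j ~[ β₀ ] w k → j ≡ k)
    where

    open Width W
    open SmallPowers smallPowers

    Agree : K → (K → F) → (K → F) → Set ℓ
    Agree ε s t = ∀ j → j < τ → s j ~[ ε ] t j

    Agree-sym : ∀ {ε s t} → Agree ε s t → Agree ε t s
    Agree-sym e j p = ~-sym (e j p)

    Agree-trans : ∀ {ε s t u} → Agree ε s t → Agree ε t u → Agree ε s u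
    Agree-trans e f j p = ~-trans (e j p) (f j p)

    Agree-mono : ∀ {ε ε′ s t} → ε ≤ ε′ → Agree ε′ s t → Agree ε s t
    Agree-mono p e j q = ~-mono p (e j q)

    -- Agreement below min(ε, β₀) is compatibility of s j with w j.
    Der : K → (K → F) → Set ℓ
    Der ε s = ∀ j → j < τ → L ε (s j) × (∀ ξ → ξ < ε → ξ < β₀ → s j ξ ≡ w j ξ)

    Der-resp : ∀ {ε s t} → Agree ε s t → Der ε s → Der ε t
    Der-resp e d j p = L-resp (e j p) (proj₁ (d j p)) ,
      λ ξ q r → trans (sym (e j p ξ q)) (proj₂ (d j p) ξ q r)

    Der-down : ∀ {ε ε′ s} → ε ≤ ε′ → Der ε′ s → Der ε s
    Der-down p d j q = L-down p (proj₁ (d j q)) , λ ξ r → proj₂ (d j q) ξ (<-≤-trans r p)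

    extendAll : ∀ {ε ε′ s} → ε ≤ ε′ → (∀ j → j < τ → L ε (s j)) →
      Σ[ t ∈ (K → F) ] ((∀ j → j < τ → L ε′ (t j)) × Agree ε t s)
    extendAll {ε} {ε′} {s} ε≤ε′ l = t , (λ j p → proj₁ (t-spec j p)) , λ j p → proj₂ (t-spec j p)
      where
      t : K → F
      t j with dec (j < τ)
      ... | yes p = proj₁ (L-extend ε≤ε′ (l j p))
      ... | no _ = λ _ → 𝟎
      t-spec : ∀ j → j < τ → L ε′ (t j) × t j ~[ ε ] s j
      t-spec j p with dec (j < τ)
      ... | yes q = proj₂ (L-extend ε≤ε′ (l j q))
      ... | no ¬q = ⊥-elim (¬q p)

    Der-extend : ∀ {ε ε′ s} → ε ≤ ε′ → Der ε s → Σ[ t ∈ (K → F) ] (Der ε′ t × Agree ε s t)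
    Der-extend {ε} {ε′} {s} ε≤ε′ d with <-or-≥ ε β₀ | <-or-≥ ε′ β₀
    ... | inj₂ β₀≤ε | _ = let (t , l , e) = extendAll ε≤ε′ (λ j p → proj₁ (d j p)) in
      t , (λ j p → l j p , λ ξ _ ξ<β₀ → trans (e j p ξ (<-≤-trans ξ<β₀ β₀≤ε))
                              (proj₂ (d j p) ξ (<-≤-trans ξ<β₀ β₀≤ε) ξ<β₀)) , Agree-sym e
    ... | inj₁ ε<β₀ | inj₁ ε′<β₀ = w , (λ j p → L-down (<⇒≤ ε′<β₀) (wL j p) , λ _ _ _ → refl) ,
      λ j p ξ q → proj₂ (d j p) ξ q (<-trans q ε<β₀)
    ... | inj₁ ε<β₀ | inj₂ β₀≤ε′ = let (t , l , e) = extendAll β₀≤ε′ wL in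
      t , (λ j p → l j p , λ ξ _ ξ<β₀ → e j p ξ ξ<β₀) ,
      λ j p ξ q → trans (proj₂ (d j p) ξ q (<-trans q ε<β₀)) (sym (e j p ξ (<-trans q ε<β₀)))

    Der-exists : ∀ ε → Σ[ t ∈ (K → F) ] Der ε t
    Der-exists ε = let (t , d , _) = Der-extend {s = w} (𝟎≤ ε) (λ _ _ → L-𝟎 , λ ξ p → ⊥-elim (≮𝟎 p)) in t , d

    derIndex : K → (K → F) → K
    derIndex ε s = index (mu ε) (λ j → lab ε (s j))

    derIndex-< : ∀ {ε s} → Der ε s → derIndex ε s < size (mu ε)
    derIndex-< {ε} d = index-< λ j p → lab-< ε (proj₁ (d j p))

    derIndex-inj : ∀ {ε s t} → Der ε s → Der ε t → derIndex ε s ≡ derIndex ε t → Agree ε s t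
    derIndex-inj {ε} d d′ e j p = lab-inj ε (proj₁ (d j p)) (proj₁ (d′ j p))
      (index-inj (λ j p → lab-< ε (proj₁ (d j p))) (λ j p → lab-< ε (proj₁ (d′ j p))) e j p)

    Names : K → (K → K) → (K → F) → Set ℓ
    Names i δ x = fst i ≡ τ ×
      (∀ j → j < τ → decode (fst (snd i)) j 𝟎 ≡ δ j × decode (snd (snd i)) j ~[ δ j ] x j)

    module _ (θ : K) where

      Addresses : (K → K) × (K → F) → Set ℓ
      Addresses (δ , x) = ∀ j → j < τ → δ j < θ × L (δ j) (x j)

      private
        module M = PairingOn (mu-pairing θ)

        label : (K → K) × (K → F) → K → K
        label (δ , x) j = M.pair (δ j) (lab (δ j) (x j))

        δ< : ∀ {a} → Addresses a → ∀ {j} → j < τ → proj₁ a j < mu θ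
        δ< h p = <-≤-trans (proj₁ (h _ p)) (a≤a⊔b θ ω)

        lab<′ : ∀ {a} → Addresses a → ∀ {j} → j < τ → lab (proj₁ a j) (proj₂ a j) < mu θ
        lab<′ h p = <-≤-trans (lab-< _ (proj₂ (h _ p))) (mu-mono (<⇒≤ (proj₁ (h _ p))))

        label-< : ∀ a → Addresses a → ∀ j → j < τ → label a j < mu θ
        label-< a h j p = M.pair-closed (δ< {a} h p) (lab<′ {a} h p)

        name : ∀ δ x → (∀ j → j < τ → δ j < θ × L (δ j) (x j)) → ∃[ i ] Names i δ x
        name δ x h =
          let (c , e) = encode τ (S 𝟎) (λ j _ → δ j)
              (c′ , e′) = encode τ θ x
              i = pair τ (pair c c′)
              snd-i = snd-pair τ (pair c c′)
          in i , fst-pair τ (pair c c′) , λ j p →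
               trans (cong (λ k → decode k j 𝟎) (trans (cong fst snd-i) (fst-pair c c′))) (e j p 𝟎 <S) ,
               λ ξ q → trans (cong (λ k → decode k j ξ) (trans (cong snd snd-i) (snd-pair c c′)))
                         (e′ j p ξ (<-trans q (proj₁ (h j p))))

      abstract
        names-bounded : ∃[ β ] (∀ δ x → (∀ j → j < τ → δ j < θ × L (δ j) (x j)) →
          ∃[ i ] (i < β × Names i δ x))
        names-bounded = proj₁ reps , λ δ x h → transfer δ x h (proj₂ reps (δ , x) h)
          where
          J : (K → K) × (K → F) → K
          J a = index (mu θ) (label a)
          reps : ∃[ β ] (∀ a → Addresses a → Σ[ a′ ∈ _ ] Σ[ h ∈ Addresses a′ ]
            (J a′ ≡ J a × proj₁ (name (proj₁ a′) (proj₂ a′) h) < β))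
          reps = representatives Addresses J (size (mu θ)) (λ a h → index-< (label-< a h))
            (λ a h → proj₁ (name (proj₁ a) (proj₂ a) h))
          transfer : ∀ δ x → (h : Addresses (δ , x)) →
            (Σ[ a′ ∈ _ ] Σ[ h ∈ Addresses a′ ]
              (J a′ ≡ J (δ , x) × proj₁ (name (proj₁ a′) (proj₂ a′) h) < proj₁ reps)) →
            ∃[ i ] (i < proj₁ reps × Names i δ x)
          transfer δ x h ((δ′ , x′) , h′ , e , i<) =
            let (i , nτ , n) = name δ′ x′ h′ in
            i , i< , nτ , λ j p →
              let eq = index-inj (label-< (δ′ , x′) h′) (label-< (δ , x) h) e j p
                  (e₁ , e₂) = M.pair-injective (δ< {δ′ , x′} h′ p) (lab<′ {δ′ , x′} h′ p)
                                (δ< {δ , x} h p) (lab<′ {δ , x} h p) eq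
              in relabel e₁ e₂ (proj₂ (h′ j p)) (proj₂ (h j p)) (n j p)
            where
            relabel : ∀ {δ δ′ v} {x x′ y : F} → δ′ ≡ δ → lab δ′ x′ ≡ lab δ x → L δ′ x′ → L δ x →
              v ≡ δ′ × y ~[ δ′ ] x′ → v ≡ δ × y ~[ δ ] x
            relabel refl e l′ l (p , q) = p , ~-trans q (lab-inj _ l′ l e)

    module Seal (D : K → (K → F) → Set ℓ)
      (D-up : ∀ {ε ε′ s t} → ε ≤ ε′ → Der ε s → Der ε′ t → Agree ε s t → D ε s → D ε′ t)
      (D-dense : ∀ {ε s} → Der ε s →
        Σ[ ε′ ∈ K ] Σ[ t ∈ (K → F) ] (ε ≤ ε′ × Der ε′ t × Agree ε s t × D ε′ t))
      where

      Target : K → (K → F) → K → K → Set ℓ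
      Target ε s ε′ d = ε ≤ ε′ × Der ε′ (decode d) × Agree ε s (decode d) × D ε′ (decode d)

      target : ∀ ε s → Der ε s → Σ[ ε′ ∈ K ] Σ[ d ∈ K ] Target ε s ε′ d
      target ε s der =
        let (ε′ , t , p , der′ , e , dt) = D-dense der
            (d , e′) = encode τ ε′ t
            der″ = Der-resp (Agree-sym e′) der′
        in ε′ , d , p , der″ , Agree-trans e (Agree-sym (Agree-mono p e′)) ,
           D-up ≤-refl der′ der″ (Agree-sym e′) dt

      abstract
        target-bounded : ∀ ε → ∃[ β ] (∀ s → Der ε s →
          Σ[ ε′ ∈ K ] Σ[ d ∈ K ] (ε′ < β × d < β × Target ε s ε′ d))
        target-bounded ε = proj₁ reps , λ s der → transfer s der (proj₂ reps s der)
          where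
          val : ∀ s → Der ε s → K
          val s der = let (ε′ , d , _) = target ε s der in ε′ ⊔ d
          reps : ∃[ β ] (∀ s → Der ε s → Σ[ s′ ∈ (K → F) ] Σ[ der ∈ Der ε s′ ]
            (derIndex ε s′ ≡ derIndex ε s × val s′ der < β))
          reps = representatives (Der ε) (derIndex ε) (size (mu ε)) (λ s d → derIndex-< d) val
          transfer : ∀ s → Der ε s → (Σ[ s′ ∈ (K → F) ] Σ[ der ∈ Der ε s′ ]
            (derIndex ε s′ ≡ derIndex ε s × val s′ der < proj₁ reps)) →
            Σ[ ε′ ∈ K ] Σ[ d ∈ K ] (ε′ < proj₁ reps × d < proj₁ reps × Target ε s ε′ d)
          transfer s der (s′ , der′ , e , v<) =
            let (ε′ , d , p , q , a , r) = target ε s′ der′ in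
            ε′ , d , ≤-<-trans (a≤a⊔b ε′ d) v< , ≤-<-trans (b≤a⊔b ε′ d) v< ,
            p , q , Agree-trans (derIndex-inj der der′ (sym e)) a , r

      pairs-bounded : ∀ δ → ∃[ β ] (∀ a b → a < δ → b < δ → pair a b < β)
      pairs-bounded δ = bound₂ δ δ pair

      h : K → K
      h δ = proj₁ (pairs-bounded δ) ⊔ (proj₁ (target-bounded δ) ⊔ (proj₁ (names-bounded δ) ⊔ β₀))

      abstract
        pair-< : ∀ {α a b} → Closed h α → a < α → b < α → pair a b < α
        pair-< {α} {a} {b} (lim , cl) a<α b<α =
          <-trans (proj₂ (pairs-bounded (S (a ⊔ b))) a b (≤⇒<S (a≤a⊔b a b)) (≤⇒<S (b≤a⊔b a b)))
            (≤-<-trans (a≤a⊔b _ _) (cl _ (IsLimit-S lim (⊔-lub< a<α b<α))))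

        target-< : ∀ {α} → Closed h α → ∀ {ε s} → ε < α → Der ε s →
          Σ[ ε′ ∈ K ] Σ[ d ∈ K ] (ε′ < α × d < α × Target ε s ε′ d)
        target-< {α} (lim , cl) {ε} {s} ε<α der =
          let (ε′ , d , p , q , t) = proj₂ (target-bounded ε) s der
              b<α = ≤-<-trans (≤-trans (a≤a⊔b _ _) (b≤a⊔b _ _)) (cl ε ε<α)
          in ε′ , d , <-trans p b<α , <-trans q b<α , t

        name-< : ∀ {α} → Closed h α → ∀ {θ} → θ < α → ∀ δ x →
          (∀ j → j < τ → δ j < θ × L (δ j) (x j)) → ∃[ i ] (i < α × Names i δ x)
        name-< {α} (lim , cl) {θ} θ<α δ x a =
          let (i , i< , n) = proj₂ (names-bounded θ) δ x a
          in i , <-trans i< (≤-<-trans (≤-trans (a≤a⊔b _ β₀)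
               (≤-trans (b≤a⊔b (proj₁ (target-bounded θ)) _) (b≤a⊔b _ _))) (cl θ θ<α)) , n

        β₀-< : ∀ {α} → Closed h α → β₀ < α
        β₀-< (((δ , δ<α) , _) , cl) = ≤-<-trans (≤-trans (b≤a⊔b _ β₀)
          (≤-trans (b≤a⊔b (proj₁ (target-bounded δ)) _) (b≤a⊔b _ _))) (cl δ δ<α)

      X : K → Pred K ℓ
      X i p = Σ[ ε ∈ K ] Σ[ d ∈ K ] (p ≡ pair i (pair ε d) × Der ε (decode d) × D ε (decode d))

      X⇒D : ∀ {i i′ ε d} → X i (pair i′ (pair ε d)) → Der ε (decode d) × D ε (decode d)
      X⇒D (ε′ , d′ , e , r) with pair-injective e
      ... | _ , e′ with pair-injective e′
      ... | refl , refl = r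

      A : K → Pred K ℓ
      A i β = (X i ∩ (_< β) ≐ Z β) × Closed h β

      A-cofinal : ∀ i → CofinalIn {0ℓ} U (A i)
      A-cofinal i = (λ _ → _) , λ β _ →
        let (α , g , lim , cl) = IsStationary⇒Closed (guess (X i)) (λ δ → h δ ⊔ β)
        in α , (g , lim , λ δ p → ≤-<-trans (a≤a⊔b (h δ) β) (cl δ p)) ,
           <⇒≤ (≤-<-trans (b≤a⊔b (h _) β) (cl _ (proj₂ (proj₁ lim))))

      module _ {α} (cof : E≥ χ α) (cl : Closed h α)
        (hit : ∀ i → i < α → IsSup (λ β → β ∈ C α × (∀ {δ} → succω (C α ∩ (β ≤_)) δ → A i δ)) α)
        {s} (der : Der α s) where

        private
          lim : IsLimit α
          lim = proj₁ cl

          Origin : K → Address → Set ℓ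
          Origin j (δ , x) = C α δ × L δ x × s j ~[ α ] br α (δ , x)

          address : K → Address
          address j with dec (Σ[ a ∈ Address ] Origin j a)
          ... | yes (a , _) = a
          ... | no _ = 𝟎 , λ _ → 𝟎

          δs : K → K
          δs j = proj₁ (address j)

          xs : K → F
          xs j = proj₂ (address j)

          origin : ∀ j → j < τ → Origin j (address j)
          origin j p with dec (Σ[ a ∈ Address ] Origin j a)
          ... | yes (_ , o) = o
          ... | no ¬o = let (δ , x , o) = L-limit⇒ lim (proj₁ (der j p)) in ⊥-elim (¬o ((δ , x) , o))

          heights-bounded : ∃[ θ ] (θ < α × (∀ j → j < τ → δs j < θ))
          heights-bounded = bounded cof lim δs λ j p → C-⊆ lim (proj₁ (origin j p))

          θ : K
          θ = proj₁ heights-bounded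

          named : ∃[ i ] (i < α × Names i δs xs)
          named = name-< cl (proj₁ (proj₂ heights-bounded)) δs xs λ j p →
            proj₂ (proj₂ heights-bounded) j p , proj₁ (proj₂ (origin j p))

          i : K
          i = proj₁ named

          found : ∃[ γ ] ((γ ∈ C α × (∀ {δ} → succω (C α ∩ (γ ≤_)) δ → A i δ)) × ((θ ⊔ i) ⊔ β₀) < γ)
          found = IsSup-above (hit i (proj₁ (proj₂ named)))
            (⊔-lub< (⊔-lub< (proj₁ (proj₂ heights-bounded)) (proj₁ (proj₂ named))) (β₀-< cl))

          γ : K
          γ = proj₁ found

          Cγ : C α γ
          Cγ = proj₁ (proj₁ (proj₂ found))

          θ≤γ : θ ≤ γ
          θ≤γ = <⇒≤ (≤-<-trans (≤-trans (a≤a⊔b θ i) (a≤a⊔b _ _)) (proj₂ (proj₂ found)))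

          i<γ : i < γ
          i<γ = ≤-<-trans (≤-trans (b≤a⊔b θ i) (a≤a⊔b _ _)) (proj₂ (proj₂ found))

          β : K
          β = nxt (C α) γ

          β-next : C α β × γ < β × β < α
          β-next = nxt-C lim (C-⊆ lim Cγ)

          γ<β : γ < β
          γ<β = proj₁ (proj₂ β-next)

          β∈A : A i β
          β∈A = proj₂ (proj₁ (proj₂ found)) (nxt∈succω lim Cγ)

          isPred : IsPred α γ β
          isPred = Cγ , γ<β , λ c Cc c<β → ≮⇒≥ λ γ<c → <⇒≱ c<β (nxt-least Cc γ<c)

          y : K → F
          y j = br α (δs j , xs j)

          s~y : Agree α s y
          s~y j p = proj₂ (proj₂ (origin j p))

          y-der : Der γ y
          y-der = Der-resp (Agree-mono (<⇒≤ (C-⊆ lim Cγ)) s~y) (Der-down (<⇒≤ (C-⊆ lim Cγ)) der)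

          tgt : Σ[ ε ∈ K ] Σ[ d ∈ K ] (ε < β × d < β × Target γ y ε d)
          tgt = target-< (proj₂ β∈A) γ<β y-der

          ε d : K
          ε = proj₁ tgt
          d = proj₁ (proj₂ tgt)

          ε<β : ε < β
          ε<β = proj₁ (proj₂ (proj₂ tgt))

          tgt′ : Target γ y ε d
          tgt′ = proj₂ (proj₂ (proj₂ (proj₂ tgt)))

          guessed : Z β (pair i (pair ε d))
          guessed = proj₁ (proj₁ β∈A) ((ε , d , refl , proj₁ (proj₂ tgt′) , proj₂ (proj₂ (proj₂ tgt′))) ,
            pair-< (proj₂ β∈A) (<-trans i<γ γ<β)
              (pair-< (proj₂ β∈A) ε<β (proj₁ (proj₂ (proj₂ (proj₂ tgt))))))

          idx≡i : idx β ≡ i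
          idx≡i = let (_ , _ , e , _) = proj₁ (proj₂ (proj₁ β∈A) (least-sat (Z β) guessed))
                  in trans (cong fst e) (fst-pair i _)

          names : Names (idx β) δs xs
          names = subst (λ i → Names i δs xs) (sym idx≡i) (proj₂ (proj₂ named))

          out : ∀ {k} → k < wid β → k < τ
          out = subst (_ <_) (proj₁ names)

          into : ∀ {k} → k < τ → k < wid β
          into = subst (_ <_) (sym (proj₁ names))

          nod~ : ∀ j → j < τ → xs j ~[ δs j ] nod β j
          nod~ j p = ~-sym (proj₂ (proj₂ names j p))

          lev≡ : ∀ j → j < τ → δs j ≡ lev β j
          lev≡ j p = sym (proj₁ (proj₂ names j p))

          y≡ : ∀ j → j < τ → ∀ ξ → y j ξ ≡ br α (lev β j , nod β j) ξ
          y≡ j p = br-≡ (lev≡ j p) (nod~ j p)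

          matches : ∀ j → j < τ → Match β (address j) j
          matches j p = into p , lev≡ j p , nod~ j p

          match-unique : ∀ j → j < τ → least (Match β (address j)) ≡ j
          match-unique j p = least-unique _ (matches j p) λ { k (q , e , x~) →
            let y~ : ∀ ξ → y j ξ ≡ y k ξ
                y~ ξ = trans (br-≡ e x~ ξ) (sym (y≡ k (out q) ξ))
            in w-inj k j (out q) p λ ξ ξ<β₀ →
                 let ξ<α = <-trans ξ<β₀ (β₀-< cl) in
                 trans (sym (proj₂ (der k (out q)) ξ ξ<α ξ<β₀))
                   (trans (s~y k (out q) ξ ξ<α) (trans (sym (y~ ξ))
                     (trans (sym (s~y j p ξ ξ<α)) (proj₂ (der j p) ξ ξ<α ξ<β₀)))) }

          b : K → Address → K
          b = branch L (C α)

          sealing : ∃ (Sealing L β γ b)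
          sealing =
            let (γ≤ε , der-d , y~d , _) = tgt′
                (z , lz , z~d) = extendAll (<⇒≤ ε<β) (λ j p → proj₁ (der-d j p))
                (c , c~z) = encode τ β z
            in c , (λ k q → let p = out q in
                   L-resp (~-sym (c~z k p)) (lz k p) ,
                   ~-trans (~-mono (<⇒≤ γ<β) (c~z k p)) (~-trans (~-mono γ≤ε (z~d k p))
                     (~-trans (~-sym (y~d k p)) (λ ξ _ → y≡ k p ξ)))) ,
                 ε , d , ε<β , subst (λ i → Z β (pair i (pair ε d))) (sym idx≡i) guessed ,
                 λ k q → let p = out q in
                   ~-trans (~-sym (z~d k p)) (~-sym (~-mono (<⇒≤ ε<β) (c~z k p)))

          c* : K
          c* = least (Sealing L β γ b)

          sealed : Sealing L β γ b c*
          sealed = least-sat (Sealing L β γ b) (proj₂ sealing)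

          y~c* : ∀ j → j < τ → y j ~[ β ] decode c* j
          y~c* j p ξ ξ<β = split (<-or-≥ ξ γ)
            where
            split : ξ < γ ⊎ γ ≤ ξ → y j ξ ≡ decode c* j ξ
            split (inj₁ ξ<γ) = trans (y≡ j p ξ) (sym (proj₂ (proj₁ sealed j (into p)) ξ ξ<γ))
            split (inj₂ γ≤ξ) = trans
              (br-choice (proj₁ β-next) isPred
                (<⇒≤ (<-≤-trans (proj₂ (proj₂ heights-bounded) j p) θ≤γ)) ξ γ≤ξ ξ<β)
              (trans (cong (λ f → f ξ) (choice-sealing {L} {β} {γ} {b} ((j , matches j p) , sealing)))
                (cong (λ k → decode c* k ξ) (match-unique j p)))

        seal : D α s
        seal =
          let (ε* , d* , ε*<β , z , d~c) = proj₂ sealed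
              (der* , D*) = X⇒D (proj₁ (proj₂ (proj₁ β∈A) z))
              β≤α = <⇒≤ (proj₂ (proj₂ β-next))
          in D-up (≤-trans (<⇒≤ ε*<β) β≤α) der* der
               (λ k p → ~-trans (d~c k (into p)) (~-mono (<⇒≤ ε*<β)
                 (~-trans (~-sym (y~c* k p)) (~-mono β≤α (~-sym (s~y k p)))))) D*

      abstract
        sealed-level : ∃[ α ] (∀ s → Der α s → D α s)
        sealed-level =
          let (α , (cof , hit) , cl) =
                IsStationary⇒Closed (proj₂ (proj₂ (proj₂ (proj₂ p14))) A A-cofinal) h
          in α , λ s der → seal cof cl hit der

  injects : (A : Setoid ℓ ℓ) (let open Setoid A) (J : Carrier → K) (ν : K) → (∀ x → J x < ν) →
    (∀ x y → J x ≡ J y → x ≈ y) → ∣ A ∣≤ ν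
  injects A J ν J< J-inj = record
    { to        = λ x → below (least (Value x)) (≤-<-trans (least-min (Value x) (self x)) (J< x))
    ; cong      = λ {x} {y} x≈y → seg≡ (least-cong
        (λ v (z , z≈x , e) → z , A.trans z≈x x≈y , e)
        (λ v (z , z≈y , e) → z , A.trans z≈y (A.sym x≈y) , e))
    ; injective = λ {x} {y} e →
        let (z , z≈x , p) = least-sat (Value x) (self x)
            (u , u≈y , q) = least-sat (Value y) (self y)
        in A.trans (A.sym z≈x) (A.trans (J-inj z u (trans p (trans (cong value e) (sym q)))) u≈y)
    }
    where
    module A = Setoid A
    -- J need not respect the equality of A.
    Value : A.Carrier → Pred K ℓ
    Value x v = Σ[ y ∈ A.Carrier ] (y A.≈ x × J y ≡ v)
    self : ∀ x → Value x (J x)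
    self x = x , A.refl , refl

  module Souslin {τ} (W : Width τ) (w : K → F) (β₀ : K)
    (wL : ∀ j → j < τ → L β₀ (w j))
    (w-inj : ∀ j k → j < τ → k < τ → w j ~[ β₀ ] w k → j ≡ k)
    (P : SPO {ℓ})
    where

    open Derived W w β₀ wL w-inj
    open SmallPowers (Width.smallPowers W)
    open StrictPartialOrder P using (_≈_) renaming (_<_ to _≺ᴾ_)

    record Presentation : Set ℓ where
      field
        ht      : ∥ P ∥ → K
        sq      : ∥ P ∥ → K → F
        der     : ∀ x → Der (ht x) (sq x)
        realise : ∀ ε s → Der ε s → Σ[ x ∈ ∥ P ∥ ] (ht x ≡ ε × Agree ε (sq x) s)
        ≺⇒      : ∀ {x y} → x ≺ᴾ y → ht x < ht y × Agree (ht x) (sq x) (sq y)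
        ≺⇐      : ∀ {x y} → ht x < ht y → Agree (ht x) (sq x) (sq y) → x ≺ᴾ y
        ≈⇒      : ∀ {x y} → x ≈ y → ht x ≡ ht y × Agree (ht x) (sq x) (sq y)
        ≈⇐      : ∀ {x y} → ht x ≡ ht y → Agree (ht x) (sq x) (sq y) → x ≈ y

    module _ (pres : Presentation) where
      open Presentation pres

      predecessor : ∀ x {a} → a < ht x → Σ[ y ∈ ∥ P ∥ ] (y ≺ᴾ x × ht y ≡ a)
      predecessor x {a} a<ht =
        let (y , e , s) = realise a (sq x) (Der-down (<⇒≤ a<ht) (der x))
        in y , ≺⇐ (subst (_< ht x) (sym e) a<ht) (subst (λ b → Agree b (sq y) (sq x)) (sym e) s) , e

      height : ∀ x → Height P x (ht x)
      height x = (λ (y , y≺x) → below (ht y) (proj₁ (≺⇒ y≺x))) , record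
        { isOrderMonomorphism = record
          { isOrderHomomorphism = record
            { cong = λ e → proj₁ (≈⇒ e)
            ; mono = λ p → proj₁ (≺⇒ p) }
          ; injective = λ { {y , p} {z , q} e → ≈⇐ e (agree p q (inj₂ e)) }
          ; cancel = λ { {y , p} {z , q} r → ≺⇐ r (agree p q (inj₁ r)) } }
        ; surjective = λ a → let (y , y≺x , e) = predecessor x (segOut a) in
            (y , y≺x) , λ z≈y → trans (proj₁ (≈⇒ z≈y)) e }
        where
        agree : ∀ {y z} → y ≺ᴾ x → z ≺ᴾ x → ht y ≤ ht z → Agree (ht y) (sq y) (sq z)
        agree p q r = Agree-trans (proj₂ (≺⇒ p)) (Agree-mono r (Agree-sym (proj₂ (≺⇒ q))))

      height-unique : ∀ {x α} → Height P x α → α ≡ ht x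
      height-unique {x} {α} (f , iso) = ≤-antisym
        (≮⇒≥ λ ht<α → let (z , e) = surjective (below (ht x) ht<α) in
          <-irrefl (subst (_< ht x) (trans (sym (fixed z)) (e (StrictPartialOrder.Eq.refl P)))
            (proj₁ (≺⇒ (proj₂ z)))))
        (≮⇒≥ λ α<ht → let (y , y≺x , e) = predecessor x α<ht in
          <-irrefl (subst (_< α) (trans (fixed (y , y≺x)) e) (segOut (f (y , y≺x)))))
        where
        open IsOrderIsomorphism iso
        Fixed : K → Set ℓ
        Fixed a = ∀ z → ht (proj₁ z) ≡ a → value (f z) ≡ a
        fixed′ : ∀ a → Fixed a
        fixed′ = wfInd Fixed λ a ih z e → ≤-antisym
          (≮⇒≥ λ a<fz →
            let (u , eq) = surjective (below a (<-trans a<fz (segOut (f z))))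
                fu≡a = eq {u} (StrictPartialOrder.Eq.refl P)
                u<z = cancel {u} {z} (subst (_< value (f z)) (sym fu≡a) a<fz)
                ht< = subst (ht (proj₁ u) <_) e (proj₁ (≺⇒ u<z))
            in <-irrefl (subst (_< a) (trans (sym (ih _ ht< u refl)) fu≡a) ht<))
          (≮⇒≥ λ fz<a →
            let (y , y≺z , e′) = predecessor (proj₁ z) (subst (value (f z) <_) (sym e) fz<a)
                u = y , StrictPartialOrder.trans P y≺z (proj₂ z)
                fy≡fz = ih _ fz<a u e′
            in <-irrefl (subst₂ _<_ (trans (proj₁ (≈⇒ (injective {u} {z} fy≡fz))) e) refl
                 (subst (_< a) (sym e′) fz<a)))
        fixed : ∀ z → value (f z) ≡ ht (proj₁ z)
        fixed z = fixed′ _ z refl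

      der-at : ∀ {x ε} → ht x ≡ ε → Der ε (sq x)
      der-at {x} refl = der x

      small-levels : ∀ α → ∣ levelOf P α ∣<κ
      small-levels α = size (mu α) , injects (levelOf P α) (λ (x , _) → derIndex α (sq x)) (size (mu α))
        (λ (x , h) → derIndex-< (at x h))
        (λ (x , h) (y , k) e → ≈⇐ (trans (sym (height-unique h)) (height-unique k))
          (subst (λ ε → Agree ε (sq x) (sq y)) (height-unique h) (derIndex-inj (at x h) (at y k) e)))
        where
        at : ∀ x → Height P x α → Der α (sq x)
        at x h = der-at (sym (height-unique h))

      no-branch : ¬ (Σ[ B ∈ Pred ∥ P ∥ ℓ ]
        ((∀ {x y} → x ∈ B → y ∈ B → x ≺ᴾ y ⊎ x ≈ y ⊎ y ≺ᴾ x) ×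
         (∀ α → ∃[ x ] (x ∈ B × Height P x α))))
      no-branch (B , chain , cofinal) =
        let (α , sealed) = Seal.sealed-level D D-up D-dense
            (x , x∈B , hx) = cofinal α
            e = sym (height-unique hx)
        in sealed (sq x) (der-at e) (x , x∈B , e , λ _ _ → ~-refl)
        where
        D : K → (K → F) → Set ℓ
        D ε s = ¬ (Σ[ x ∈ ∥ P ∥ ] (x ∈ B × ht x ≡ ε × Agree ε (sq x) s))

        same-level : ∀ {x y} → x ∈ B → y ∈ B → ht x ≡ ht y → Agree (ht x) (sq x) (sq y)
        same-level {x} {y} x∈B y∈B e with chain x∈B y∈B
        ... | inj₁ p = proj₂ (≺⇒ p)
        ... | inj₂ (inj₁ p) = proj₂ (≈⇒ p)
        ... | inj₂ (inj₂ p) = ⊥-elim (<-irrefl (subst (ht y <_) e (proj₁ (≺⇒ p))))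

        D-up : ∀ {ε ε′ s t} → ε ≤ ε′ → Der ε s → Der ε′ t → Agree ε s t → D ε s → D ε′ t
        D-up {ε} {ε′} {s} {t} ε≤ε′ _ _ s~t ds (x , x∈B , refl , x~t) =
          let (y , y∈B , hy) = cofinal ε
          in ds (y , y∈B , sym (height-unique hy) ,
               Agree-trans (below-x y∈B (height-unique hy) (chain y∈B x∈B))
                 (Agree-trans (Agree-mono ε≤ε′ x~t) (Agree-sym s~t)))
          where
          below-x : ∀ {y} → y ∈ B → ε ≡ ht y → y ≺ᴾ x ⊎ y ≈ x ⊎ x ≺ᴾ y → Agree ε (sq y) (sq x)
          below-x _ refl (inj₁ p) = proj₂ (≺⇒ p)
          below-x _ refl (inj₂ (inj₁ p)) = proj₂ (≈⇒ p)
          below-x _ refl (inj₂ (inj₂ p)) = ⊥-elim (<⇒≱ (proj₁ (≺⇒ p)) ε≤ε′)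

        D-dense : ∀ {ε s} → Der ε s →
          Σ[ ε′ ∈ K ] Σ[ t ∈ (K → F) ] (ε ≤ ε′ × Der ε′ t × Agree ε s t × D ε′ t)
        D-dense {ε} {s} ds = choose (dec (D (S ε₁) (split 𝟎)))
          where
          ε₁ : K
          ε₁ = ε ⊔ β₀
          ext₁ : Σ[ t ∈ (K → F) ] (Der ε₁ t × Agree ε s t)
          ext₁ = Der-extend (a≤a⊔b ε β₀) ds
          t : K → F
          t = proj₁ ext₁
          split : K → K → F
          split v j = upd (t j) ε₁ v
          split-der : ∀ {v} → v <ω → Der (S ε₁) (split v)
          split-der {v} v<ω j p = L-S⇐ (proj₁ (proj₁ (proj₂ ext₁) j p)) (inj₁ v<ω) ,
            λ ξ _ ξ<β₀ → let ξ<ε₁ = <-≤-trans ξ<β₀ (b≤a⊔b ε β₀) in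
              trans (upd-~ (t j) ε₁ v ξ ξ<ε₁) (proj₂ (proj₁ (proj₂ ext₁) j p) ξ ξ<ε₁ ξ<β₀)
          s~split : ∀ v → Agree ε s (split v)
          s~split v j p = ~-trans (proj₂ (proj₂ ext₁) j p)
            (~-sym (~-mono (a≤a⊔b ε β₀) (upd-~ (t j) ε₁ v)))
          ε≤ : ε ≤ S ε₁
          ε≤ = <⇒≤ (≤⇒<S (a≤a⊔b ε β₀))
          Result : Set ℓ
          Result = Σ[ ε′ ∈ K ] Σ[ t ∈ (K → F) ] (ε ≤ ε′ × Der ε′ t × Agree ε s t × D ε′ t)
          choose : Dec (D (S ε₁) (split 𝟎)) → Result
          choose (yes d) = S ε₁ , split 𝟎 , ε≤ , split-der 𝟎<ω , s~split 𝟎 , d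
          choose (no ¬d) = S ε₁ , split (S 𝟎) , ε≤ , split-der (num<ω 1) , s~split (S 𝟎) ,
            λ (y , y∈B , hy , y~) → ¬d λ (x , x∈B , hx , x~) →
              let 𝟎<τ = Width.positive W
                  x~y = subst (λ ε → Agree ε (sq x) (sq y)) hx (same-level x∈B y∈B (trans hx (sym hy)))
              in 𝟎≢S (trans (sym (upd-≡ (t 𝟎) ε₁ 𝟎)) (trans (sym (x~ 𝟎 𝟎<τ ε₁ <S))
                   (trans (x~y 𝟎 𝟎<τ ε₁ <S) (trans (y~ 𝟎 𝟎<τ ε₁ <S) (upd-≡ (t 𝟎) ε₁ (S 𝟎))))))

      no-antichain : ¬ (Σ[ a ∈ (K → ∥ P ∥) ]
        (Injective _≡_ _≈_ a × (∀ i j → ¬ (i ≡ j) → ¬ (a i ≺ᴾ a j))))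
      no-antichain (a , a-inj , anti) = IsRegularUncountableCardinal.cardinal reg (proj₁ room)
        (mk↣ {to = λ i → below (code i) (proj₂ room _ _ (a-below i) (index-below i))}
          λ {i} {j} e → code-inj (cong value e))
        where
        Compatible : K → K → (K → F) → Set ℓ
        Compatible i ε s = ∀ j → j < τ → ∀ ξ → ξ < ht (a i) → ξ < ε → sq (a i) j ξ ≡ s j ξ

        D : K → (K → F) → Set ℓ
        D ε s = (∃[ i ] (ht (a i) < ε × Agree (ht (a i)) (sq (a i)) s)) ⊎ (∀ i → ¬ Compatible i ε s)

        D-up : ∀ {ε ε′ s t} → ε ≤ ε′ → Der ε s → Der ε′ t → Agree ε s t → D ε s → D ε′ t
        D-up ε≤ε′ _ _ s~t (inj₁ (i , p , q)) =
          inj₁ (i , <-≤-trans p ε≤ε′ , Agree-trans q (Agree-mono (<⇒≤ p) s~t))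
        D-up ε≤ε′ _ _ s~t (inj₂ n) = inj₂ λ i c → n i λ j p ξ q r →
          trans (c j p ξ q (<-≤-trans r ε≤ε′)) (sym (s~t j p ξ r))

        D-dense : ∀ {ε s} → Der ε s →
          Σ[ ε′ ∈ K ] Σ[ t ∈ (K → F) ] (ε ≤ ε′ × Der ε′ t × Agree ε s t × D ε′ t)
        D-dense {ε} {s} ds with dec (∃[ i ] Compatible i ε s)
        ... | no ¬c = ε , s , ≤-refl , ds , (λ _ _ → ~-refl) , inj₂ λ i c → ¬c (i , c)
        ... | yes (i , c) with <-or-≥ (ht (a i)) ε
        ... | inj₁ p = ε , s , ≤-refl , ds , (λ _ _ → ~-refl) ,
                inj₁ (i , p , λ j q ξ r → c j q ξ r (<-trans r p))
        ... | inj₂ ε≤ = let (t , dt , e) = Der-extend (<⇒≤ <S) (der (a i)) in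
                S (ht (a i)) , t , ≤-trans ε≤ (<⇒≤ <S) , dt ,
                (λ j p ξ q → trans (sym (c j p ξ (<-≤-trans q ε≤) q)) (e j p ξ (<-≤-trans q ε≤))) ,
                inj₁ (i , <S , e)

        sealed : ∃[ α ] (∀ s → Der α s → D α s)
        sealed = Seal.sealed-level D D-up D-dense

        α : K
        α = proj₁ sealed

        a-below : ∀ i → ht (a i) < α
        a-below i = ≰⇒> λ α≤ → absurd α≤ (proj₂ sealed (sq (a i)) (Der-down α≤ (der (a i))))
          where
          absurd : α ≤ ht (a i) → D α (sq (a i)) → ⊥
          absurd α≤ (inj₁ (k , p , q)) =
            let k<i = <-≤-trans p α≤
            in anti k i (λ { refl → <-irrefl k<i }) (≺⇐ k<i q)
          absurd α≤ (inj₂ n) = n i λ _ _ _ _ _ → refl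

        sizes : ∃[ m ] (∀ ε → ε < α → size (mu ε) < m)
        sizes = bound α (λ ε → size (mu ε))

        room : ∃[ θ ] (∀ b c → b < α → c < proj₁ sizes → pair b c < θ)
        room = bound₂ α (proj₁ sizes) pair

        label : K → K
        label i = derIndex (ht (a i)) (sq (a i))

        index-below : ∀ i → label i < proj₁ sizes
        index-below i = <-trans (derIndex-< (der (a i))) (proj₂ sizes _ (a-below i))

        code : K → K
        code i = pair (ht (a i)) (label i)

        code-inj : ∀ {i j} → code i ≡ code j → i ≡ j
        code-inj {i} {j} e =
          let (e₁ , e₂) = pair-injective e
          in a-inj (≈⇐ e₁ (derIndex-inj (der (a i)) (der-at (sym e₁))
               (trans e₂ (cong (λ ε → derIndex ε (sq (a j))) (sym e₁)))))

      isSouslin : IsSouslin P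
      isSouslin = record
        { heights      = λ x → ht x , height x
        ; height-κ     = λ α → let (s , ds) = Der-exists α
                                   (x , e , _) = realise α s ds
                               in x , subst (Height P x) e (height x)
        ; small-levels = small-levels
        ; no-branch    = no-branch
        ; no-antichain = no-antichain
        }

  ext : Node → F
  ext x ξ with dec (ξ < dom x)
  ... | yes p = fun x (below ξ p)
  ... | no _ = 𝟎

  mk : K → F → Node
  mk δ f = node δ (λ i → f (value i))

  ext-mk : ∀ δ f → ext (mk δ f) ~[ δ ] f
  ext-mk δ f ξ ξ<δ with dec (ξ < δ)
  ... | yes _ = refl
  ... | no ¬p = ⊥-elim (¬p ξ<δ)

  graph⇒ : ∀ x {i j} → graph x (i , j) → i < dom x × ext x i ≡ j
  graph⇒ x {i} (p , e) = p , lem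
    where
    lem : ext x i ≡ _
    lem with dec (i < dom x)
    ... | yes _ = e
    ... | no ¬p = ⊥-elim (¬p p)

  graph⇐ : ∀ x {i j} → i < dom x → ext x i ≡ j → graph x (i , j)
  graph⇐ x {i} p e with dec (i < dom x)
  ... | yes _ = p , e
  ... | no ¬p = ⊥-elim (¬p p)

  ⊑⇒ : ∀ x y → x ⊑ y → dom x ≤ dom y × ext x ~[ dom x ] ext y
  ⊑⇒ x y h =
    ≮⇒≥ (λ p → <-irrefl (proj₁ (graph⇒ y (h (graph⇐ x p refl))))) ,
    λ ξ p → sym (proj₂ (graph⇒ y (h (graph⇐ x p refl))))

  ⊑⇐ : ∀ x y → dom x ≤ dom y → ext x ~[ dom x ] ext y → x ⊑ y
  ⊑⇐ x y p e {i , j} g = let (q , r) = graph⇒ x g in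
    graph⇐ y (<-≤-trans q p) (trans (sym (e i q)) r)

  ≈ₙ⇒ : ∀ x y → x ≈ₙ y → dom x ≡ dom y × ext x ~[ dom x ] ext y
  ≈ₙ⇒ x y (p , q) = ≤-antisym (proj₁ (⊑⇒ x y p)) (proj₁ (⊑⇒ y x q)) , proj₂ (⊑⇒ x y p)

  ≈ₙ⇐ : ∀ x y → dom x ≡ dom y → ext x ~[ dom x ] ext y → x ≈ₙ y
  ≈ₙ⇐ x y e a = (λ {p} → ⊑⇐ x y (inj₂ e) a {p}) ,
    (λ {p} → ⊑⇐ y x (inj₂ (sym e)) (~-sym (~-mono (inj₂ (sym e)) a)) {p})

  ⊊⇒ : ∀ x y → x ⊊ y → dom x < dom y × ext x ~[ dom x ] ext y
  ⊊⇒ x y (p , ¬q) = ≰⇒> (λ r → ¬q (λ {z} → ⊑⇐ y x r (~-sym (~-mono r (proj₂ (⊑⇒ x y p)))) {z})) ,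
    proj₂ (⊑⇒ x y p)

  ⊊⇐ : ∀ x y → dom x < dom y → ext x ~[ dom x ] ext y → x ⊊ y
  ⊊⇐ x y p e = (λ {z} → ⊑⇐ x y (<⇒≤ p) e {z}) , λ q → <⇒≱ p (proj₁ (⊑⇒ y x q))

  T : Pred Node ℓ
  T x = L (dom x) (ext x)

  T-downward-closed : DownwardClosed T
  T-downward-closed x y x⊑y l = let (p , e) = ⊑⇒ x y x⊑y in L-resp (~-sym e) (L-down p l)

  T-mk : ∀ {δ f} → L δ f → T (mk δ f)
  T-mk {δ} {f} l = L-resp (~-sym (ext-mk δ f)) l

  T-prolific : Prolific T
  T-prolific x l i p = y , T-mk (L-S⇐ l p) ,
    (λ { {a , b} g → let (q , e) = graph⇒ y g in to a b q (trans (sym (ext-mk _ f a q)) e) }) ,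
    λ { {a , b} (inj₁ g) → let (q , e) = graph⇒ x g
                               q′ = <-trans q <S
                           in graph⇐ y q′ (trans (ext-mk _ f a q′) (trans (upd-~ (ext x) (dom x) i a q) e))
      ; (inj₂ refl) → graph⇐ y <S (trans (ext-mk _ f (dom x) <S) (upd-≡ (ext x) (dom x) i)) }
    where
    f : F
    f = upd (ext x) (dom x) i
    y : Node
    y = mk (S (dom x)) f
    to : ∀ a b → a < S (dom x) → f a ≡ b → graph x (a , b) ⊎ (dom x , i) ≡ (a , b)
    to a b q e with <S⇒≤ q
    ... | inj₁ r = inj₁ (graph⇐ x r (trans (sym (upd-~ (ext x) (dom x) i a r)) e))
    ... | inj₂ refl = inj₂ (cong (a ,_) (trans (sym (upd-≡ (ext x) a i)) e))

  T-slim : Slim T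
  T-slim α = choose (<-or-≥ α ω)
    where
    level : Setoid ℓ ℓ
    level = StrictPartialOrder.Eq.setoid (nodes ↾ (λ x → x ∈ T × dom x ≡ α))
    into : ∣ level ∣≤ mu α
    into = injects level (λ (x , _) → lab α (ext x)) (mu α)
      (λ { (x , l , refl) → lab-< α l })
      (λ { (x , l , refl) (y , k , e) eq → ≈ₙ⇐ x y (sym e)
             (lab-inj α l (subst (λ α → L α (ext y)) e k) eq) })
    choose : α < ω ⊎ ω ≤ α → ∣ level ∣≤ α ⊎ ∣ level ∣≤ℵ₀
    choose (inj₂ ω≤α) = inj₁ (subst (∣ level ∣≤_) (≤-antisym (⊔-lub ≤-refl ω≤α) (a≤a⊔b α ω)) into)
    choose (inj₁ α<ω) = inj₂ (injection
      (subst (∣ level ∣≤_) (≤-antisym (⊔-lub (<⇒≤ α<ω) ≤-refl) (b≤a⊔b α ω)) into) Seg-ω↣ℕ)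

  T-souslin : IsSouslin (nodes ↾ T)
  T-souslin = Souslin.isSouslin width-1 (λ _ _ → 𝟎) 𝟎 (λ _ _ → L-𝟎)
    (λ j k p q _ → trans (is𝟎 p) (sym (is𝟎 q))) (nodes ↾ T) record
    { ht      = λ (x , _) → dom x
    ; sq      = λ (x , _) _ → ext x
    ; der     = λ (x , l) _ _ → l , λ _ _ p → ⊥-elim (≮𝟎 p)
    ; realise = λ ε s d → (mk ε (s 𝟎) , T-mk (proj₁ (d 𝟎 <S))) , refl ,
        λ j p ξ q → trans (ext-mk ε (s 𝟎) ξ q) (cong (λ k → s k ξ) (sym (is𝟎 p)))
    ; ≺⇒      = λ {(x , _)} {(y , _)} p → proj₁ (⊊⇒ x y p) , λ _ _ → proj₂ (⊊⇒ x y p)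
    ; ≺⇐      = λ {(x , _)} {(y , _)} p e → ⊊⇐ x y p (e 𝟎 <S)
    ; ≈⇒      = λ {(x , _)} {(y , _)} p → proj₁ (≈ₙ⇒ x y p) , λ _ _ → proj₂ (≈ₙ⇒ x y p)
    ; ≈⇐      = λ {(x , _)} {(y , _)} p e → ≈ₙ⇐ x y p (e 𝟎 <S)
    }
    where
    is𝟎 : ∀ {j} → j < S 𝟎 → j ≡ 𝟎
    is𝟎 p = ≤-antisym (<S⇒≤ p) (𝟎≤ _)

  T-free : (∀ μ → IsCardinal μ → Power<κ μ χ) → Free χ T
  T-free pow τ 0<τ τ<χ β w w∈T w-inj =
    Souslin.isSouslin (width-<χ pow 0<τ τ<χ) (total w) β
      (λ j p → subst₂ L (proj₂ (w∈T (below j p))) refl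
        (L-resp (~-sym (total-at w (below j p))) (proj₁ (w∈T (below j p)))))
      (λ j k p q e → cong value (w-inj {below j p} {below k q}
        (≈ₙ⇐ (w (below j p)) (w (below k q)) (trans (dom-w j p) (sym (dom-w k q)))
          (~-trans (~-sym (total-at w (below j p))) (~-trans (~-mono (inj₂ (dom-w j p)) e)
            (total-at w (below k q)))))))
      (derivedTree T 0<τ w) record
    { ht      = ht
    ; sq      = λ (f , _) → total f
    ; der     = λ (f , l , same , c) j p → let i = below j p in
        subst (λ ε → L ε (total f j)) (same i i₀) (L-resp (~-sym (total-at f i)) (l i)) ,
        λ ξ q r → trans (total-at f i ξ q) (trans
          (compat i (f i) (c i) ξ (subst (ξ <_) (same i₀ i) q) (subst (ξ <_) (sym (dom-w j p)) r))
          (sym (total-at w i ξ q)))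
    ; realise = λ ε s d →
        ((λ i → mk ε (s (value i))) , (λ i → T-mk (proj₁ (d _ (segOut i)))) , (λ _ _ → refl) ,
          λ i → comparable i ε (s (value i)) (proj₂ (d _ (segOut i)))) ,
        refl , λ j p ξ q → trans (total-at (λ i → mk ε (s (value i))) (below j p) ξ q) (ext-mk ε (s j) ξ q)
    ; ≺⇒      = λ {x} {y} h → proj₁ (⊊⇒ (proj₁ x i₀) (proj₁ y i₀) (h i₀)) , λ j p → let i = below j p in
        ~-trans (total-at (proj₁ x) i) (~-trans
          (~-mono (inj₂ (proj₁ (proj₂ (proj₂ x)) i₀ i)) (proj₂ (⊊⇒ (proj₁ x i) (proj₁ y i) (h i))))
          (~-sym (total-at (proj₁ y) i)))
    ; ≺⇐      = λ {x} {y} p e i → ⊊⇐ (proj₁ x i) (proj₁ y i)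
        (subst₂ _<_ (proj₁ (proj₂ (proj₂ x)) i₀ i) (proj₁ (proj₂ (proj₂ y)) i₀ i) p)
        (agree-at x y e i)
    ; ≈⇒      = λ {x} {y} h → proj₁ (≈ₙ⇒ (proj₁ x i₀) (proj₁ y i₀) (h i₀)) , λ j p → let i = below j p in
        ~-trans (total-at (proj₁ x) i) (~-trans
          (~-mono (inj₂ (proj₁ (proj₂ (proj₂ x)) i₀ i)) (proj₂ (≈ₙ⇒ (proj₁ x i) (proj₁ y i) (h i))))
          (~-sym (total-at (proj₁ y) i)))
    ; ≈⇐      = λ {x} {y} p e i → ≈ₙ⇐ (proj₁ x i) (proj₁ y i)
        (subst₂ _≡_ (proj₁ (proj₂ (proj₂ x)) i₀ i) (proj₁ (proj₂ (proj₂ y)) i₀ i) p)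
        (agree-at x y e i)
    }
    where
    i₀ : Seg τ
    i₀ = below (proj₁ 0<τ) (proj₂ 0<τ)

    total : (Seg τ → Node) → K → F
    total f j with dec (j < τ)
    ... | yes p = ext (f (below j p))
    ... | no _ = λ _ → 𝟎

    total-at : ∀ {δ} (f : Seg τ → Node) (i : Seg τ) → total f (value i) ~[ δ ] ext (f i)
    total-at f i ξ _ with dec (value i < τ)
    ... | yes _ = refl
    ... | no ¬p = ⊥-elim (¬p (segOut i))

    D : Set ℓ
    D = ∥ derivedTree T 0<τ w ∥

    ht : D → K
    ht (f , _) = dom (f i₀)

    dom-w : ∀ j (p : j < τ) → dom (w (below j p)) ≡ β
    dom-w j p = proj₂ (w∈T (below j p))

    compat : ∀ i x → x ⊑ w i ⊎ w i ⊑ x → ∀ ξ → ξ < dom x → ξ < dom (w i) → ext x ξ ≡ ext (w i) ξ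
    compat i x (inj₁ p) ξ q r = proj₂ (⊑⇒ x (w i) p) ξ q
    compat i x (inj₂ p) ξ q r = sym (proj₂ (⊑⇒ (w i) x p) ξ r)

    comparable : ∀ i ε f → (∀ ξ → ξ < ε → ξ < β → f ξ ≡ total w (value i) ξ) →
      mk ε f ⊑ w i ⊎ w i ⊑ mk ε f
    comparable i ε f h with <-or-≥ ε β
    ... | inj₁ p = inj₁ (⊑⇐ (mk ε f) (w i) (<⇒≤ (subst (ε <_) (sym (proj₂ (w∈T i))) p))
            λ ξ q → trans (ext-mk ε f ξ q) (trans (h ξ q (<-trans q p)) (total-at w i ξ (<-trans q p))))
    ... | inj₂ p = inj₂ (⊑⇐ (w i) (mk ε f) (subst (_≤ ε) (sym (proj₂ (w∈T i))) p)
            λ ξ q → let q′ = subst (ξ <_) (proj₂ (w∈T i)) q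
                        q″ = <-≤-trans q′ p
                    in trans (sym (total-at w i ξ q)) (trans (sym (h ξ q″ q′)) (sym (ext-mk ε f ξ q″))))

    agree-at : ∀ (x y : D) → (∀ j → j < τ → total (proj₁ x) j ~[ ht x ] total (proj₁ y) j) →
      ∀ i → ext (proj₁ x i) ~[ dom (proj₁ x i) ] ext (proj₁ y i)
    agree-at x y e i = ~-trans (~-sym (total-at (proj₁ x) i)) (~-trans
      (~-mono (inj₂ (proj₁ (proj₂ (proj₂ x)) i i₀)) (e (value i) (segOut i)))
      (total-at (proj₁ y) i))

theorem6p2 : ∀ {ℓ} → ExcludedMiddle (suc ℓ) →
    (κ : Ordinal ℓ) → let open OnOrdinal κ in
    IsRegularUncountableCardinal →
    (χ : K) → IsCardinal χ →
    (∀ μ → IsCardinal μ → Power<κ μ χ) →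
    P₁₄ (E≥ χ) →
    Σ[ T ∈ Pred Node ℓ ] (DownwardClosed T × Prolific T × Slim T × Free χ T × IsSouslin (nodes ↾ T))
theorem6p2 em κ reg χ _ pow p14 =
  T , T-downward-closed , T-prolific , T-slim , T-free pow , T-souslin
  where open TreeConstruction em κ reg χ p14
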